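{- There is an algorithm that, given a set $\mathcal{R}$ of rules on a finite set $Q$ with $n=|Q|$ and $l=l(\mathcal{R})$, enumerates all members of $\mathcal{A}(\mathcal{R})$ (each exactly once) with $O(nl)$ delay between consecutive outputs.
   Context: A rule on $Q$ is a pair $(A,q)$ with $A\subseteq Q$, $q\in Q$; it accepts $Y\subseteq Q$ if $q\in Y$ implies $Y\cap A\neq\emptyset$. $\mathcal{K}(\mathcal{R})$ is the family of subsets accepted by all rules of $\mathcal{R}$, and $\mathcal{A}(\mathcal{R})$ is the family of $K\in\mathcal{K}(\mathcal{R})$ for which there is a sequence $\emptyset=Y_0\subseteq\dots\subseteq Y_k=K$ of members of $\mathcal{K}(\mathcal{R})$ with $|Y_{i+1}\setminus Y_i|=1$. $l(\mathcal{R})=\sum_{(A,q)\in\mathcal{R}}(|A|+1)$, assumed to satisfy $l(\mathcal{R})\ge n$. -}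

module Defs where

open import Data.Bool using (Bool; true; false; if_then_else_)
open import Data.Fin using (Fin; zero; suc; toℕ; fromℕ; inject₁)
open import Data.Fin.Subset using (Subset; _∈_; _⊆_; _∩_; _─_; ⊥; ∣_∣; Nonempty)
open import Data.Fin.Subset.Properties using (_∈?_)
open import Data.List using (List; []; _∷_; _++_; map; length; sum; filter; allFin; concat)
open import Data.List.Membership.Propositional using () renaming (_∉_ to _∉ₗ_)
open import Data.List.Relation.Binary.Permutation.Propositional using (_↭_)
open import Data.List.Relation.Binary.Pointwise using (Pointwise)
open import Data.List.Relation.Unary.All using (All)
open import Data.Nat using (ℕ; zero; suc; pred; _+_; _<_; _≡ᵇ_; _<ᵇ_)
open import Data.Product using (Σ-syntax; ∃-syntax; _×_; _,_)
open import Relation.Binary.PropositionalEquality using (_≡_)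

-- The ground set Q is Fin n.

Rule : ℕ → Set
Rule n = Subset n × Fin n

Accepts : ∀ {n} → Rule n → Subset n → Set
Accepts (A , q) Y = q ∈ Y → Nonempty (Y ∩ A)

-- A set of rules is a list; that it has no repetitions is a separate
-- hypothesis wherever it matters.

𝒦 : ∀ {n} → List (Rule n) → Subset n → Set
𝒦 R Y = All (λ r → Accepts r Y) R

𝒜 : ∀ {n} → List (Rule n) → Subset n → Set
𝒜 {n} R K =
  𝒦 R K ×
  (∃[ k ] Σ[ Y ∈ (Fin (suc k) → Subset n) ]
    Y zero ≡ ⊥ ×
    Y (fromℕ k) ≡ K ×
    (∀ i → 𝒦 R (Y i)) ×
    (∀ (i : Fin k) → Y (inject₁ i) ⊆ Y (suc i) ×
                     ∣ Y (suc i) ─ Y (inject₁ i) ∣ ≡ 1))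

size : ∀ {n} → List (Rule n) → ℕ
size R = sum (map (λ (A , q) → ∣ A ∣ + 1) R)

-- Model of computation: a random access machine with structured control.
--
-- A program has finitely many scalar variables and finitely many
-- one-dimensional arrays (each named by a number occurring in its text).
-- The only arithmetic is successor and (truncated) predecessor, so that
-- charging one unit per step does not give the machine any hidden
-- parallelism; usual random access machines simulate it with constant
-- overhead. Expressions belong to the program text, hence their size is
-- a constant, independent of the input.

data Expr : Set where
  lit : ℕ → Expr
  var : ℕ → Expr
  arr : ℕ → Expr → Expr
  inc : Expr → Expr
  dec : Expr → Expr

infix 5 _==_ _<<_

data Test : Set where
  _==_ : Expr → Expr → Test
  _<<_ : Expr → Expr → Test

infix  4 _≔_ _[_]≔_ IF_THEN_ELSE_ WHILE_DO_
infixr 3 _⨾_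

data Program : Set where
  skip          : Program
  _≔_           : ℕ → Expr → Program
  _[_]≔_        : ℕ → Expr → Expr → Program
  write         : Expr → Program
  flush         : Program
  _⨾_           : Program → Program → Program
  IF_THEN_ELSE_ : Test → Program → Program → Program
  WHILE_DO_     : Test → Program → Program

record State : Set where
  constructor state
  field
    vars : ℕ → ℕ
    arrs : ℕ → ℕ → ℕ

open State public

⟦_⟧ᵉ : Expr → State → ℕ
⟦ lit k ⟧ᵉ   s = k
⟦ var x ⟧ᵉ   s = vars s x
⟦ arr a e ⟧ᵉ s = arrs s a (⟦ e ⟧ᵉ s)
⟦ inc e ⟧ᵉ   s = suc (⟦ e ⟧ᵉ s)
⟦ dec e ⟧ᵉ   s = pred (⟦ e ⟧ᵉ s)

⟦_⟧ᵗ : Test → State → Bool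
⟦ d == e ⟧ᵗ s = ⟦ d ⟧ᵉ s ≡ᵇ ⟦ e ⟧ᵉ s
⟦ d << e ⟧ᵗ s = ⟦ d ⟧ᵉ s <ᵇ ⟦ e ⟧ᵉ s

update : {B : Set} → (ℕ → B) → ℕ → B → ℕ → B
update f i b j = if i ≡ᵇ j then b else f j

-- The trace of a run has one entry per unit of time. `write` appends one
-- number to the output buffer; `flush` outputs the content of the buffer
-- and empties it.

data Event : Set where
  step   : Event
  writes : ℕ → Event
  output : Event

infix 2 ⟨_,_⟩⇓⟨_,_⟩

-- ⟨ P , s ⟩⇓⟨ s′ , τ ⟩: started in state s, the program P halts in state s′,
-- and its trace is τ.

data ⟨_,_⟩⇓⟨_,_⟩ : Program → State → State → List Event → Set where
  skip : ∀ {s} →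
    ⟨ skip , s ⟩⇓⟨ s , step ∷ [] ⟩
  assign : ∀ {x e s} →
    ⟨ x ≔ e , s ⟩⇓⟨ state (update (vars s) x (⟦ e ⟧ᵉ s)) (arrs s) , step ∷ [] ⟩
  store : ∀ {a d e s} →
    ⟨ a [ d ]≔ e , s ⟩⇓⟨ state (vars s)
      (update (arrs s) a (update (arrs s a) (⟦ d ⟧ᵉ s) (⟦ e ⟧ᵉ s))) , step ∷ [] ⟩
  write : ∀ {e s} →
    ⟨ write e , s ⟩⇓⟨ s , writes (⟦ e ⟧ᵉ s) ∷ [] ⟩
  flush : ∀ {s} →
    ⟨ flush , s ⟩⇓⟨ s , output ∷ [] ⟩
  seq : ∀ {P P′ s s′ s″ τ τ′} →
    ⟨ P , s ⟩⇓⟨ s′ , τ ⟩ →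
    ⟨ P′ , s′ ⟩⇓⟨ s″ , τ′ ⟩ →
    ⟨ P ⨾ P′ , s ⟩⇓⟨ s″ , τ ++ τ′ ⟩
  if-true : ∀ {t P P′ s s′ τ} →
    ⟦ t ⟧ᵗ s ≡ true →
    ⟨ P , s ⟩⇓⟨ s′ , τ ⟩ →
    ⟨ IF t THEN P ELSE P′ , s ⟩⇓⟨ s′ , step ∷ τ ⟩
  if-false : ∀ {t P P′ s s′ τ} →
    ⟦ t ⟧ᵗ s ≡ false →
    ⟨ P′ , s ⟩⇓⟨ s′ , τ ⟩ →
    ⟨ IF t THEN P ELSE P′ , s ⟩⇓⟨ s′ , step ∷ τ ⟩
  while-true : ∀ {t P s s′ s″ τ τ′} →
    ⟦ t ⟧ᵗ s ≡ true →
    ⟨ P , s ⟩⇓⟨ s′ , τ ⟩ →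
    ⟨ WHILE t DO P , s′ ⟩⇓⟨ s″ , τ′ ⟩ →
    ⟨ WHILE t DO P , s ⟩⇓⟨ s″ , step ∷ τ ++ τ′ ⟩
  while-false : ∀ {t P s} →
    ⟦ t ⟧ᵗ s ≡ false →
    ⟨ WHILE t DO P , s ⟩⇓⟨ s , step ∷ [] ⟩

nth : List ℕ → ℕ → ℕ
nth []      i       = 0
nth (x ∷ w) zero    = x
nth (x ∷ w) (suc i) = nth w i

-- The input is stored in array 0; all other memory is initially zero.

load : List ℕ → State
load w = state (λ x → 0) (update (λ a i → 0) 0 (nth w))

elements : ∀ {n} → Subset n → List (Fin n)
elements {n} A = filter (_∈? A) (allFin n)

-- The word w lists the elements of A, each exactly once, in some order.

_Lists_ : ∀ {n} → List ℕ → Subset n → Set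
w Lists A = w ↭ map toℕ (elements A)

_EncodesRule_ : ∀ {n} → List ℕ → Rule n → Set
w EncodesRule (A , q) = ∃[ v ] v Lists A × w ≡ toℕ q ∷ length v ∷ v

_Encodes_ : ∀ {n} → List ℕ → List (Rule n) → Set
_Encodes_ {n} w R =
  ∃[ ws ] Pointwise _EncodesRule_ ws R × w ≡ n ∷ length R ∷ concat ws

written : List Event → List ℕ
written []             = []
written (writes v ∷ τ) = v ∷ written τ
written (_ ∷ τ)        = written τ

-- Enumerates d τ Ks: a run with trace τ outputs exactly the sets Ks, in
-- this order, and at most d time units pass from the start to the first
-- output, between any two consecutive outputs, and from the last output
-- until the machine halts.

data Enumerates {n : ℕ} (d : ℕ) : List Event → List (Subset n) → Set where
  halt : ∀ {τ} →
    output ∉ₗ τ → written τ ≡ [] → length τ < d →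
    Enumerates d τ []
  next : ∀ {τ τ′ K Ks} →
    output ∉ₗ τ → written τ Lists K → length τ < d →
    Enumerates d τ′ Ks →
    Enumerates d (τ ++ output ∷ τ′) (K ∷ Ks)

{-# OPTIONS --safe #-}
module Submission where

-- A sequence of marks on Q stands for the family of all K ∈ 𝒜(R) containing
-- the taken and avoiding the barred elements. If the set of taken elements is
-- in 𝒜(R) and no undecided q can be added to it within 𝒦(R), then it is the
-- only member of its family; otherwise the family splits into two nonempty
-- ones, according to whether q ∈ K. So every leaf of the resulting binary
-- search tree outputs a set, and its depth is at most n. One pass over the
-- rules blocks every head whose addition violates a rule (rules whose head is
-- already taken are satisfied anyway), hence a node costs O(n + l) = O(l), and
-- between two leaves the search visits O(n) nodes.

open import Defs
open import Data.Bool using (Bool; true; false)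
open import Data.Fin using (Fin; zero; suc; toℕ; fromℕ; fromℕ<; inject₁)
import Data.Fin as Fin
open import Data.Fin.Induction using (<-weakInduction; >-weakInduction)
import Data.Fin.Properties as Fin
open import Data.Fin.Relation.Unary.Top using (view; ‵fromℕ; ‵inject₁; view-fromℕ; view-inject₁)
open import Data.Fin.Subset using (Subset; _⊆_; _─_; _-_; ⊤; ⁅_⁆; ∣_∣)
  renaming (_∈_ to _∈ˢ_; _∉_ to _∉ˢ_; ⊥ to ∅)
open import Data.Fin.Subset.Properties using (_∈?_; x∈p∩q⁺; x∈p∩q⁻; x∈p∧x∉q⇒x∈p─q; p─q⊆p; 
  x∈p∧x≢y⇒x∈p-y; x∈p⇒∣p-x∣<∣p∣; x∈⁅y⁆⇒x≡y; x∈⁅x⁆; ∣⁅x⁆∣≡1; ∣⊤∣≡n; 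
  ∈⊤; ∉⊥; ⊆-antisym; p⊆q⇒∣p∣≤∣q∣; drop-there)
open import Data.List using (List; []; _∷_; _++_; length; map; filter; concat; downFrom; allFin; tabulate)
open import Data.List.Membership.Propositional using (_∈_; find; lose) renaming (_∉_ to _∉ₗ_)
open import Data.List.Membership.Propositional.Properties using (∈-++⁺ˡ; ∈-++⁺ʳ; ∈-++⁻;
  ∈-map⁺; ∈-map⁻; ∈-filter⁺; ∈-filter⁻; ∈-allFin; ∈-downFrom⁺; ∈-downFrom⁻)
open import Data.List.Membership.Propositional.Properties.WithK using (unique∧set⇒bag)
import Data.List.Properties as List
open import Data.List.Relation.Binary.BagAndSetEquality using (∼bag⇒↭)
open import Data.List.Relation.Binary.Permutation.Propositional using (↭-sym)
open import Data.List.Relation.Binary.Permutation.Propositional.Properties using (∈-resp-↭; ↭-length)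
open import Data.List.Relation.Binary.Pointwise using (Pointwise; []; _∷_)
open import Data.List.Relation.Unary.All as All using (All; []; _∷_)
open import Data.List.Relation.Unary.AllPairs using ([]; _∷_)
open import Data.List.Relation.Unary.Any using (Any; here; there)
open import Data.List.Relation.Unary.Unique.Propositional using (Unique)
import Data.List.Relation.Unary.Unique.Propositional.Properties as Unique
open import Data.Nat using (ℕ; zero; suc; pred; _+_; _*_; _≤_; _<_; _<ᵇ_; _≡ᵇ_; z≤n; s≤s; s≤s⁻¹)
import Data.Nat.Properties as ℕ
open import Data.Nat.Tactic.RingSolver using (solve-∀)
open import Data.Product using (Σ-syntax; ∃-syntax; ∃; _×_; _,_; proj₁; proj₂)
open import Data.Sum using (_⊎_; inj₁; inj₂)
import Data.Vec as Vec
open import Data.Vec using ([]; _∷_; here; there)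
open import Data.Vec.Functional using (updateAt)
open import Data.Vec.Functional.Properties using (updateAt-updates; updateAt-minimal)
open import Data.Vec.Properties using (lookup∘tabulate; []=⇒lookup; lookup⇒[]=; tabulate-cong)
open import Function using (_∘_; id)
open import Function.Bundles using (_⇔_; mk⇔)
open import Relation.Binary.Definitions using (tri<; tri≈; tri>)
open import Relation.Binary.PropositionalEquality using (_≡_; _≢_; refl; sym; trans; cong; subst)
open import Relation.Nullary using (¬_; Dec; yes; no; contradiction)
open import Relation.Nullary.Decidable using (_×-dec_; _→-dec_; _⊎-dec_; decidable-stable)

-- Both halves of a split are nonempty because the set of taken elements is in 𝒜(R) at every node:
-- it is itself a member avoiding `q`, and by addability its extension by `q` is a member containing
-- `q`. Hence no descent is wasted. The machine has no recursion, so the walk through the tree uses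
-- an explicit stack of branching elements, and the marking is restored by undoing one mark per pop.
-- A subtree is therefore simulated in continuation form: from the way the loop goes on after
-- leaving the subtree one obtains the run that enters it. The obstacle is the wait after a leaf,
-- which comprises pops out of finished subtrees and then a new descent. A budget of one round per
-- stack entry plus `n + 2` further rounds pays for it: each pop uses up the round of its own entry,
-- and after a flip at most `n` levels are descended. A round costs O(l) because n ≤ l, and the
-- total is at most a multiple of 1 + nl, where the summand 1 covers n = 0.

private variable
  n k : ℕ

-- Markings of the ground set and the sets they encode

data Mark : Set where
  undecided taken barred : Mark

code : Mark → ℕ
code undecided = 0
code taken     = 1
code barred    = 2

code-injective : ∀ x y → code x ≡ code y → x ≡ y
code-injective undecided undecided _ = refl
code-injective taken     taken     _ = refl
code-injective barred    barred    _ = refl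

_≟ᵐ_ : (x y : Mark) → Dec (x ≡ y)
x ≟ᵐ y with code x ℕ.≟ code y
... | yes e = yes (code-injective x y e)
... | no ne = no (ne ∘ cong code)

isTaken : Mark → Bool
isTaken undecided = false
isTaken taken     = true
isTaken barred    = false

isTaken⁻ : ∀ m → isTaken m ≡ true → m ≡ taken
isTaken⁻ taken refl = refl

chosen : (Fin n → Mark) → Subset n
chosen f = Vec.tabulate (isTaken ∘ f)

∈-chosen⁺ : ∀ (f : Fin n → Mark) {q} → f q ≡ taken → q ∈ˢ chosen f
∈-chosen⁺ f {q} e = lookup⇒[]= q _ (trans (lookup∘tabulate _ q) (cong isTaken e))

∈-chosen⁻ : ∀ (f : Fin n → Mark) {q} → q ∈ˢ chosen f → f q ≡ taken
∈-chosen⁻ f {q} q∈ = isTaken⁻ (f q) (trans (sym (lookup∘tabulate _ q)) ([]=⇒lookup q∈))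

_[_↦_] : (Fin n → Mark) → Fin n → Mark → Fin n → Mark
f [ q ↦ m ] = updateAt f q (λ _ → m)

↦-≡ : ∀ (f : Fin n → Mark) q m → (f [ q ↦ m ]) q ≡ m
↦-≡ f q m = updateAt-updates q f

↦-≢ : ∀ (f : Fin n → Mark) {p} q m → p ≢ q → (f [ q ↦ m ]) p ≡ f p
↦-≢ f {p} q m p≢q = updateAt-minimal p q f p≢q

-- The condition that `A` meets the taken elements together with `q`, phrased without forming that
-- set: these are the two tests that the program makes on each element of `A`.
Supported : (Fin n → Mark) → Fin n → Subset n → Set
Supported f q A = ∃[ a ] a ∈ˢ A × (a ≡ q ⊎ f a ≡ taken)

Permits : (Fin n → Mark) → Fin n → Rule n → Set
Permits f q r = proj₂ r ≡ q → Supported f q (proj₁ r)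

Addable : List (Rule n) → (Fin n → Mark) → Fin n → Set
Addable R f q = f q ≡ undecided × All (Permits f q) R

supported? : ∀ (f : Fin n → Mark) q A → Dec (Supported f q A)
supported? f q A = Fin.any? λ a → (a ∈? A) ×-dec ((a Fin.≟ q) ⊎-dec (f a ≟ᵐ taken))

addable? : ∀ (R : List (Rule n)) f q → Dec (Addable R f q)
addable? R f q = (f q ≟ᵐ undecided) ×-dec All.all? (λ r → (proj₂ r Fin.≟ q) →-dec supported? f q (proj₁ r)) R

Compatible : (Fin n → Mark) → Subset n → Set
Compatible f K = ∀ q → (f q ≡ taken → q ∈ˢ K) × (f q ≡ barred → q ∉ˢ K)

compatible-taken : ∀ (f : Fin n → Mark) {q K} → Compatible f K → q ∈ˢ K → Compatible (f [ q ↦ taken ]) K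
compatible-taken f {q} c q∈K p with p Fin.≟ q
... | yes refl = (λ _ → q∈K) , λ e → contradiction (trans (sym e) (↦-≡ f q taken)) λ ()
... | no p≢q rewrite ↦-≢ f q taken p≢q = c p

compatible-barred : ∀ (f : Fin n → Mark) {q K} → Compatible f K → q ∉ˢ K → Compatible (f [ q ↦ barred ]) K
compatible-barred f {q} c q∉K p with p Fin.≟ q
... | yes refl = (λ e → contradiction (trans (sym e) (↦-≡ f q barred)) λ ()) , λ _ → q∉K
... | no p≢q rewrite ↦-≢ f q barred p≢q = c p

compatible-forget : ∀ (f : Fin n → Mark) {q m K} → f q ≡ undecided → Compatible (f [ q ↦ m ]) K → Compatible f K
compatible-forget f {q} {m} e c p with p Fin.≟ q
... | yes refl = (λ e′ → contradiction (trans (sym e) e′) λ ()) , λ e′ → contradiction (trans (sym e) e′) λ ()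
... | no p≢q = subst (λ x → (x ≡ taken → _) × (x ≡ barred → _)) (↦-≢ f q m p≢q) (c p)

-- Finite sets, least elements and extension of chains

-- If `x` and `y` differed, `x` would survive in `p - y`, giving 1 ≤ |p - y| < |p| = 1.
∣p∣≡1⇒x≡y : ∀ {p : Subset n} {x y} → ∣ p ∣ ≡ 1 → x ∈ˢ p → y ∈ˢ p → x ≡ y
∣p∣≡1⇒x≡y {p = p} {x} {y} p≡1 x∈p y∈p = decidable-stable (x Fin.≟ y) λ x≢y →
  ℕ.<⇒≱ (x∈p⇒∣p-x∣<∣p∣ y∈p)
    (subst (_≤ ∣ p - y ∣) (trans (∣⁅x⁆∣≡1 x) (sym p≡1))
      (p⊆q⇒∣p∣≤∣q∣ λ z∈ → subst (_∈ˢ p - y) (sym (x∈⁅y⁆⇒x≡y x z∈)) (x∈p∧x≢y⇒x∈p-y x∈p x≢y)))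

x∈p─q⇒x∉q : ∀ (p q : Subset n) {x} → x ∈ˢ p ─ q → x ∉ˢ q
x∈p─q⇒x∉q (_ ∷ p) (true  ∷ q) ()         here
x∈p─q⇒x∉q (_ ∷ p) (true  ∷ q) (there x∈) (there x∈q) = x∈p─q⇒x∉q p q x∈ x∈q
x∈p─q⇒x∉q (_ ∷ p) (false ∷ q) (there x∈) (there x∈q) = x∈p─q⇒x∉q p q x∈ x∈q

-- Fixing the least addable element makes the branching canonical, so that the element found by the
-- machine is the one at which the tree branches.
Least : (Fin n → Set) → Fin n → Set
Least P q = P q × (∀ p → p Fin.< q → ¬ P p)

least? : ∀ {P : Fin n → Set} → (∀ q → Dec (P q)) → ∃ (Least P) ⊎ (∀ q → ¬ P q)
least? {zero}  P? = inj₂ λ ()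
least? {suc n} P? with P? zero
... | yes P₀ = inj₁ (zero , P₀ , λ p ())
... | no ¬P₀ with least? (P? ∘ suc)
...   | inj₂ none         = inj₂ λ { zero → ¬P₀ ; (suc q) → none q }
...   | inj₁ (q , Pq , l) = inj₁ (suc q , Pq , λ { zero _ → ¬P₀ ; (suc p) p<q → l p (s≤s⁻¹ p<q) })

-- Chains grow at their upper end, so an index is split into the top one and the earlier ones.
snoc : ∀ {X : Set} → (Fin k → X) → X → Fin (suc k) → X
snoc Y Z i with view i
... | ‵fromℕ     = Z
... | ‵inject₁ j = Y j

snoc-fromℕ : ∀ {X : Set} (Y : Fin k → X) Z → snoc Y Z (fromℕ k) ≡ Z
snoc-fromℕ {k} Y Z rewrite view-fromℕ k = refl

snoc-inject₁ : ∀ {X : Set} (Y : Fin k → X) Z i → snoc Y Z (inject₁ i) ≡ Y i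
snoc-inject₁ Y Z i rewrite view-inject₁ i = refl

snoc-all : ∀ {X : Set} {P : X → Set} {Y : Fin k → X} {Z} → (∀ i → P (Y i)) → P Z → ∀ i → P (snoc Y Z i)
snoc-all PY PZ i with view i
... | ‵fromℕ     = PZ
... | ‵inject₁ j = PY j

snoc-chain : ∀ {X : Set} {_~_ : X → X → Set} {Y : Fin (suc k) → X} {Z} →
  (∀ i → Y (inject₁ i) ~ Y (suc i)) → Y (fromℕ k) ~ Z →
  ∀ i → snoc Y Z (inject₁ i) ~ snoc Y Z (suc i)
snoc-chain {Y = Y} {Z} Y~ ~Z i rewrite snoc-inject₁ Y Z i with view i
... | ‵fromℕ     = ~Z
... | ‵inject₁ j = Y~ j

chosen-⊆ : ∀ (f : Fin n → Mark) q → f q ≡ undecided → chosen f ⊆ chosen (f [ q ↦ taken ])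
chosen-⊆ f q fq {x} x∈ = ∈-chosen⁺ (f [ q ↦ taken ]) (trans (↦-≢ f q taken x≢q) (∈-chosen⁻ f x∈))
  where
  x≢q : x ≢ q
  x≢q refl = contradiction (trans (sym fq) (∈-chosen⁻ f x∈)) λ ()

chosen-─ : ∀ (f : Fin n → Mark) q → f q ≡ undecided → ∣ chosen (f [ q ↦ taken ]) ─ chosen f ∣ ≡ 1
chosen-─ f q fq = trans (cong ∣_∣ (⊆-antisym ⊆⁅q⁆ ⁅q⁆⊆)) (∣⁅x⁆∣≡1 q)
  where
  f′ = f [ q ↦ taken ]
  ⊆⁅q⁆ : chosen f′ ─ chosen f ⊆ ⁅ q ⁆
  ⊆⁅q⁆ {x} x∈ with x Fin.≟ q
  ... | yes refl = x∈⁅x⁆ q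
  ... | no x≢q = contradiction
    (∈-chosen⁺ f (trans (sym (↦-≢ f q taken x≢q)) (∈-chosen⁻ f′ (p─q⊆p (chosen f′) (chosen f) x∈))))
    (x∈p─q⇒x∉q (chosen f′) (chosen f) x∈)
  ⁅q⁆⊆ : ⁅ q ⁆ ⊆ chosen f′ ─ chosen f
  ⁅q⁆⊆ x∈ rewrite x∈⁅y⁆⇒x≡y q x∈ = x∈p∧x∉q⇒x∈p─q (∈-chosen⁺ f′ (↦-≡ f q taken))
    λ q∈ → contradiction (trans (sym fq) (∈-chosen⁻ f q∈)) λ ()

chosen-barred : ∀ (f : Fin n → Mark) q → f q ≡ undecided → chosen (f [ q ↦ barred ]) ≡ chosen f
chosen-barred f q fq = tabulate-cong same
  where
  same : ∀ p → isTaken ((f [ q ↦ barred ]) p) ≡ isTaken (f p)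
  same p with p Fin.≟ q
  ... | yes refl rewrite ↦-≡ f q barred | fq = refl
  ... | no p≢q = cong isTaken (↦-≢ f q barred p≢q)

-- Accessible sets and addable elements

module _ {R : List (Rule n)} where

  𝒜-∅ : 𝒜 R ∅
  𝒜-∅ = 𝒦∅ , 0 , (λ _ → ∅) , refl , refl , (λ _ → 𝒦∅) , λ ()
    where
    𝒦∅ : 𝒦 R ∅
    𝒦∅ = All.universal (λ r q∈∅ → contradiction q∈∅ ∉⊥) R

  𝒜-extend : ∀ {K L} → 𝒜 R K → 𝒦 R L → K ⊆ L → ∣ L ─ K ∣ ≡ 1 → 𝒜 R L
  𝒜-extend {K} {L} (_ , k , Y , Y₀ , refl , 𝒦Y , chain) 𝒦L K⊆L one =
    𝒦L , suc k , snoc Y L , trans (snoc-inject₁ Y L zero) Y₀ , snoc-fromℕ Y L ,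
    snoc-all {P = 𝒦 R} 𝒦Y 𝒦L , snoc-chain {_~_ = λ S T → S ⊆ T × ∣ T ─ S ∣ ≡ 1} chain (K⊆L , one)

  -- A rule whose head was already taken has a witness that survives enlargement; a rule with head
  -- `q` gets its witness from the permission.
  addable-𝒦 : ∀ f q → Addable R f q → 𝒦 R (chosen f) → 𝒦 R (chosen (f [ q ↦ taken ]))
  addable-𝒦 f q (fq , permits) 𝒦f = All.zipWith accept (permits , 𝒦f)
    where
    f′ = f [ q ↦ taken ]
    accept : ∀ {r} → Permits f q r × Accepts r (chosen f) → Accepts r (chosen f′)
    accept {A , p} (permit , acc) p∈ with p Fin.≟ q
    ... | no p≢q with a , a∈ ← acc (∈-chosen⁺ f (trans (sym (↦-≢ f q taken p≢q)) (∈-chosen⁻ f′ p∈))) =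
      a , x∈p∩q⁺ (chosen-⊆ f q fq (proj₁ (x∈p∩q⁻ _ A a∈)) , proj₂ (x∈p∩q⁻ _ A a∈))
    ... | yes p≡q with permit p≡q
    ...   | a , a∈A , inj₁ refl = a , x∈p∩q⁺ (∈-chosen⁺ f′ (↦-≡ f q taken) , a∈A)
    ...   | a , a∈A , inj₂ fa   = a , x∈p∩q⁺ (chosen-⊆ f q fq (∈-chosen⁺ f fa) , a∈A)

  -- Along a chain ∅ = Y₀ ⊆ … ⊆ L, the first element outside chosen f would be addable.
  maximal : ∀ f {L} → (∀ q → ¬ Addable R f q) → 𝒜 R L → Compatible f L → chosen f ≡ L
  maximal f {L} none (_ , k , Y , Y₀ , Yₖ , 𝒦Y , chain) compat =
    ⊆-antisym (λ x∈ → proj₁ (compat _) (∈-chosen⁻ f x∈))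
              (λ x∈L → Y⊆chosen (fromℕ k) (subst (_ ∈ˢ_) (sym Yₖ) x∈L))
    where
    Y⊆L : ∀ i → Y i ⊆ L
    Y⊆L = >-weakInduction (λ i → Y i ⊆ L) (subst (_ ∈ˢ_) Yₖ) (λ i Y⊆ x∈ → Y⊆ (proj₁ (chain i) x∈))

    grow : ∀ i → Y (inject₁ i) ⊆ chosen f → Y (suc i) ⊆ chosen f
    grow i Y⊆ {x} x∈ with f x in fx | x ∈? Y (inject₁ i)
    ... | taken     | _       = ∈-chosen⁺ f fx
    ... | barred    | _       = contradiction (Y⊆L (suc i) x∈) (proj₂ (compat x) fx)
    ... | undecided | yes x∈Y = Y⊆ x∈Y
    -- Here `x` is the element that enters the chain at this step; it turns out to be addable,
    -- against the assumption.
    ... | undecided | no  x∉Y = contradiction (fx , All.map permit (𝒦Y (suc i))) (none x)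
      where
      permit : ∀ {r} → Accepts r (Y (suc i)) → Permits f x r
      permit {A , _} acc refl with a , a∈ ← acc x∈ with x∈p∩q⁻ _ A a∈ | a ∈? Y (inject₁ i)
      ... | _    , a∈A | yes a∈Y = a , a∈A , inj₂ (∈-chosen⁻ f (Y⊆ a∈Y))
      -- A witness that was not there before must be the single new element, hence `x` itself.
      ... | a∈Y⁺ , a∈A | no  a∉Y = a , a∈A , inj₁
        (∣p∣≡1⇒x≡y (proj₂ (chain i)) (x∈p∧x∉q⇒x∈p─q a∈Y⁺ a∉Y) (x∈p∧x∉q⇒x∈p─q x∈ x∉Y))

    Y⊆chosen : ∀ i → Y i ⊆ chosen f
    Y⊆chosen = <-weakInduction (λ i → Y i ⊆ chosen f) (λ x∈ → contradiction (subst (_ ∈ˢ_) Y₀ x∈) ∉⊥) grow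

-- The search tree

-- The number bounds the height; the list holds the leaf sets in output order, the half with `q`
-- taken coming first.
data Tree {n} (R : List (Rule n)) : ℕ → (Fin n → Mark) → List (Subset n) → Set where
  leaf : ∀ {k f} → (∀ q → ¬ Addable R f q) → Tree R k f (chosen f ∷ [])
  node : ∀ {k f q Ks Ls} → Least (Addable R f) q →
    Tree R k (f [ q ↦ taken ]) Ks → Tree R k (f [ q ↦ barred ]) Ls → Tree R (suc k) f (Ks ++ Ls)

-- `U` over-approximates the undecided elements. Either decision about `q` allows `q` to be deleted
-- from it, so its cardinality serves as fuel.
tree : ∀ (R : List (Rule n)) k f U → (∀ q → f q ≡ undecided → q ∈ˢ U) → ∣ U ∣ ≤ k → ∃ (Tree R k f)
tree R k f U open∈U ∣U∣≤k with least? (addable? R f)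
... | inj₂ none = _ , leaf none
... | inj₁ (q , l@((fq , _) , _)) with k | ℕ.<-≤-trans (x∈p⇒∣p-x∣<∣p∣ (open∈U q fq)) ∣U∣≤k
...   | suc k | s≤s ∣U-q∣≤k =
  _ , node l (proj₂ (tree R k _ (U - q) (open∈ taken (λ ())) ∣U-q∣≤k))
             (proj₂ (tree R k _ (U - q) (open∈ barred (λ ())) ∣U-q∣≤k))
  where
  open∈ : ∀ m → m ≢ undecided → ∀ p → (f [ q ↦ m ]) p ≡ undecided → p ∈ˢ U - q
  open∈ m m≢ p e with p Fin.≟ q
  ... | yes refl = contradiction (trans (sym (↦-≡ f q m)) e) m≢
  ... | no p≢q = x∈p∧x≢y⇒x∈p-y (open∈U p (trans (sym (↦-≢ f q m p≢q)) e)) p≢q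

module _ {R : List (Rule n)} where

  -- The hypothesis on `chosen f` is an invariant: taking an addable element extends the chain by
  -- one set, and barring leaves the set unchanged.
  tree-sound : ∀ {k f Ks K} → Tree R k f Ks → 𝒜 R (chosen f) → K ∈ Ks → 𝒜 R K
  tree-sound (leaf _) 𝒜f (here refl) = 𝒜f
  tree-sound {f = f} (node {q = q} {Ks} (add@(fq , _) , _) t u) 𝒜f K∈ with ∈-++⁻ Ks K∈
  ... | inj₁ K∈Ks = tree-sound t
    (𝒜-extend 𝒜f (addable-𝒦 f q add (proj₁ 𝒜f)) (chosen-⊆ f q fq) (chosen-─ f q fq)) K∈Ks
  ... | inj₂ K∈Ls = tree-sound u (subst (𝒜 R) (sym (chosen-barred f q fq)) 𝒜f) K∈Ls

  tree-complete : ∀ {k f Ks K} → Tree R k f Ks → 𝒜 R K → Compatible f K → K ∈ Ks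
  tree-complete {f = f} (leaf none) 𝒜K c = here (sym (maximal f none 𝒜K c))
  tree-complete {f = f} {K = K} (node {q = q} {Ks} l t u) 𝒜K c with q ∈? K
  ... | yes q∈K = ∈-++⁺ˡ (tree-complete t 𝒜K (compatible-taken f c q∈K))
  ... | no  q∉K = ∈-++⁺ʳ Ks (tree-complete u 𝒜K (compatible-barred f c q∉K))

  tree-compatible : ∀ {k f Ks K} → Tree R k f Ks → K ∈ Ks → Compatible f K
  tree-compatible {f = f} (leaf _) (here refl) q =
    ∈-chosen⁺ f , λ fq q∈ → contradiction (trans (sym fq) (∈-chosen⁻ f q∈)) λ ()
  tree-compatible {f = f} (node {Ks = Ks} ((fq , _) , _) t u) K∈ with ∈-++⁻ Ks K∈
  ... | inj₁ K∈Ks = compatible-forget f fq (tree-compatible t K∈Ks)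
  ... | inj₂ K∈Ls = compatible-forget f fq (tree-compatible u K∈Ls)

  -- The lists of the two halves are disjoint: compatibility puts `q` into every set of the first
  -- and into no set of the second.
  tree-unique : ∀ {k f Ks} → Tree R k f Ks → Unique Ks
  tree-unique (leaf _) = [] ∷ []
  tree-unique {f = f} (node {q = q} _ t u) = Unique.++⁺ (tree-unique t) (tree-unique u) λ (K∈Ks , K∈Ls) →
    proj₂ (tree-compatible u K∈Ls q) (↦-≡ f q barred) (proj₁ (tree-compatible t K∈Ks q) (↦-≡ f q taken))

-- Timed total correctness of programs

≡ᵇ-refl : ∀ m → (m ≡ᵇ m) ≡ true
≡ᵇ-refl zero    = refl
≡ᵇ-refl (suc m) = ≡ᵇ-refl m

≢⇒≡ᵇ-false : ∀ m k → m ≢ k → (m ≡ᵇ k) ≡ false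
≢⇒≡ᵇ-false zero    zero    ne = contradiction refl ne
≢⇒≡ᵇ-false zero    (suc k) ne = refl
≢⇒≡ᵇ-false (suc m) zero    ne = refl
≢⇒≡ᵇ-false (suc m) (suc k) ne = ≢⇒≡ᵇ-false m k (ne ∘ cong suc)

update-≡ : ∀ {B : Set} (g : ℕ → B) i b → update g i b i ≡ b
update-≡ g i b rewrite ≡ᵇ-refl i = refl

update-≢ : ∀ {B : Set} (g : ℕ → B) {i j} b → i ≢ j → update g i b j ≡ g j
update-≢ g {i} {j} b ne rewrite ≢⇒≡ᵇ-false i j ne = refl

written-++ : ∀ τ τ′ → written (τ ++ τ′) ≡ written τ ++ written τ′
written-++ []             τ′ = refl
written-++ (step ∷ τ)     τ′ = written-++ τ τ′
written-++ (writes v ∷ τ) τ′ = cong (v ∷_) (written-++ τ τ′)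
written-++ (output ∷ τ)   τ′ = written-++ τ τ′

∉-++ : ∀ {X : Set} {x : X} xs {ys} → x ∉ₗ xs → x ∉ₗ ys → x ∉ₗ xs ++ ys
∉-++ xs x∉xs x∉ys x∈ with ∈-++⁻ xs x∈
... | inj₁ x∈xs = x∉xs x∈xs
... | inj₂ x∈ys = x∉ys x∈ys

record Quiet (τ : List Event) (ws : List ℕ) (t : ℕ) : Set where
  constructor quietly
  field
    silent : output ∉ₗ τ
    wrote  : written τ ≡ ws
    time   : length τ ≤ t

quiet-step : ∀ {τ ws t} → Quiet τ ws t → Quiet (step ∷ τ) ws (suc t)
quiet-step (quietly o w t) = quietly (λ { (there x) → o x }) w (s≤s t)

quiet-[] : Quiet [] [] 0
quiet-[] = quietly (λ ()) refl z≤n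

quiet-++ : ∀ {τ τ′ ws ws′ t t′} → Quiet τ ws t → Quiet τ′ ws′ t′ → Quiet (τ ++ τ′) (ws ++ ws′) (t + t′)
quiet-++ {τ} {τ′} (quietly o refl t) (quietly o′ refl t′) = quietly
  (∉-++ τ o o′) (written-++ τ τ′) (subst (_≤ _) (sym (List.length-++ τ)) (ℕ.+-mono-≤ t t′))

-- A total correctness statement for one concrete initial state, with the exact word written and an
-- upper bound on the time. Proofs execute programs symbolically, so intermediate states are
-- computed, not described.
record Run (P : Program) (s : State) (ws : List ℕ) (t : ℕ) (Q : State → Set) : Set where
  constructor ran
  field
    {final} : State
    {trace} : List Event
    exec    : ⟨ P , s ⟩⇓⟨ final , trace ⟩
    quiet   : Quiet trace ws t
    post    : Q final

module _ {s : State} {Q : State → Set} where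

  weaken : ∀ {P ws t t′} → t ≤ t′ → Run P s ws t Q → Run P s ws t′ Q
  weaken t≤t′ (ran e (quietly o w t) q) = ran e (quietly o w (ℕ.≤-trans t t≤t′)) q

  mono : ∀ {P ws t Q′} → (∀ {s′} → Q s′ → Q′ s′) → Run P s ws t Q → Run P s ws t Q′
  mono Q⇒Q′ (ran e o q) = ran e o (Q⇒Q′ q)

  run-assign : ∀ {x e} → Q (state (update (vars s) x (⟦ e ⟧ᵉ s)) (arrs s)) → Run (x ≔ e) s [] 1 Q
  run-assign q = ran assign (quiet-step quiet-[]) q

  run-store : ∀ {a d e} →
    Q (state (vars s) (update (arrs s) a (update (arrs s a) (⟦ d ⟧ᵉ s) (⟦ e ⟧ᵉ s)))) →
    Run (a [ d ]≔ e) s [] 1 Q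
  run-store q = ran store (quiet-step quiet-[]) q

  run-write : ∀ {e} → Q s → Run (write e) s (⟦ e ⟧ᵉ s ∷ []) 1 Q
  run-write q = ran write (quietly (λ { (here ()) ; (there ()) }) refl (s≤s z≤n)) q

  run-seq : ∀ {P P′ ws ws′ t t′ Q′} → Run P s ws t Q′ → (∀ {s′} → Q′ s′ → Run P′ s′ ws′ t′ Q) →
    Run (P ⨾ P′) s (ws ++ ws′) (t + t′) Q
  run-seq (ran e o q) k with ran e′ o′ q′ ← k q = ran (seq e e′) (quiet-++ o o′) q′

  run-if : ∀ {d e P P′ ws t} →
    (⟦ d ⟧ᵉ s ≡ ⟦ e ⟧ᵉ s → Run P s ws t Q) → (⟦ d ⟧ᵉ s ≢ ⟦ e ⟧ᵉ s → Run P′ s ws t Q) →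
    Run (IF d == e THEN P ELSE P′) s ws (suc t) Q
  run-if {d} {e} yes-case no-case with ⟦ d ⟧ᵉ s ℕ.≟ ⟦ e ⟧ᵉ s
  ... | yes eq with ran r o q ← yes-case eq =
    ran (if-true (trans (cong (⟦ d ⟧ᵉ s ≡ᵇ_) (sym eq)) (≡ᵇ-refl (⟦ d ⟧ᵉ s))) r) (quiet-step o) q
  ... | no ne with ran r o q ← no-case ne =
    ran (if-false (≢⇒≡ᵇ-false _ _ ne) r) (quiet-step o) q

  run-while-suc : ∀ {e P k ws t} → ⟦ e ⟧ᵉ s ≡ suc k → Run (P ⨾ (WHILE lit 0 << e DO P)) s ws t Q →
    Run (WHILE lit 0 << e DO P) s ws (suc t) Q
  run-while-suc eq (ran (seq r r′) o q) = ran (while-true (cong (0 <ᵇ_) eq) r r′) (quiet-step o) q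

  run-while-zero : ∀ {e P} → ⟦ e ⟧ᵉ s ≡ 0 → Q s → Run (WHILE lit 0 << e DO P) s [] 1 Q
  run-while-zero eq q = ran (while-false (cong (0 <ᵇ_) eq)) (quiet-step quiet-[]) q

module _ {s : State} {Q : State → Set} where

  -- Unfolding a loop leaves its body as a left-nested block; reassociating exposes the next
  -- statement for execution.
  assoc-then : ∀ {P P′ P″ ws t} → Run (P ⨾ P′ ⨾ P″) s ws t Q → Run ((P ⨾ P′) ⨾ P″) s ws t Q
  assoc-then {ws = ws} {t} (ran (seq {τ = τ} r (seq {τ = τ′} {τ″} r′ r″)) o q) =
    ran (seq (seq r r′) r″) (subst (λ τ → Quiet τ ws t) (sym (List.++-assoc τ τ′ τ″)) o) q

  skip-then : ∀ {P ws t} → Run P s ws t Q → Run (skip ⨾ P) s ws (suc t) Q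
  skip-then (ran r o q) = ran (seq skip r) (quiet-step o) q

  assign-then : ∀ {x e P ws t} →
    Run P (state (update (vars s) x (⟦ e ⟧ᵉ s)) (arrs s)) ws t Q → Run (x ≔ e ⨾ P) s ws (suc t) Q
  assign-then (ran r o q) = ran (seq assign r) (quiet-step o) q

  store-then : ∀ {a d e P ws t} →
    Run P (state (vars s) (update (arrs s) a (update (arrs s a) (⟦ d ⟧ᵉ s) (⟦ e ⟧ᵉ s)))) ws t Q →
    Run (a [ d ]≔ e ⨾ P) s ws (suc t) Q
  store-then (ran r o q) = ran (seq store r) (quiet-step o) q

  if-then : ∀ {d e P P′ P″ ws t} →
    (⟦ d ⟧ᵉ s ≡ ⟦ e ⟧ᵉ s → Run (P ⨾ P″) s ws t Q) → (⟦ d ⟧ᵉ s ≢ ⟦ e ⟧ᵉ s → Run (P′ ⨾ P″) s ws t Q) →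
    Run ((IF d == e THEN P ELSE P′) ⨾ P″) s ws (suc t) Q
  if-then {d} {e} yes-case no-case with ⟦ d ⟧ᵉ s ℕ.≟ ⟦ e ⟧ᵉ s
  ... | yes eq with ran (seq r r′) o q ← yes-case eq =
    ran (seq (if-true (trans (cong (⟦ d ⟧ᵉ s ≡ᵇ_) (sym eq)) (≡ᵇ-refl (⟦ d ⟧ᵉ s))) r) r′) (quiet-step o) q
  ... | no ne with ran (seq r r′) o q ← no-case ne =
    ran (seq (if-false (≢⇒≡ᵇ-false _ _ ne) r) r′) (quiet-step o) q

-- The program

-- `status` and `blocked` are indexed by 1 + q, and `stack` and `cand` hold
-- 1 + q, so that 0 can stand for no element.

input status blocked stack : ℕ
input   = 0
status  = 1
blocked = 2
stack   = 3

depth mode ptr left len head mark idx cand : ℕ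
depth = 0
mode  = 1
ptr   = 2
left  = 3
len   = 4
head  = 5
mark  = 6
idx   = 7
cand  = 8

collect-body collect scan-body scan find-body search print-body print push flip pop : Program

-- Here and in find-body the idle branch assigns a variable to itself, so that
-- all branches end in states of the same form.
collect-body =
  IF arr input (var ptr) == var head
    THEN mark ≔ lit 0
    ELSE (IF arr status (inc (arr input (var ptr))) == lit 1 THEN mark ≔ lit 0 ELSE (mark ≔ var mark)) ⨾
  ptr ≔ inc (var ptr) ⨾
  len ≔ dec (var len)

collect = WHILE lit 0 << var len DO collect-body

-- The mark 3 differs from every status code, so `blocked` agrees with
-- `status` at an element iff the element is undecided and not blocked.
scan-body =
  head ≔ arr input (var ptr) ⨾
  ptr ≔ inc (var ptr) ⨾
  len ≔ arr input (var ptr) ⨾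
  ptr ≔ inc (var ptr) ⨾
  mark ≔ lit 3 ⨾
  collect ⨾
  (IF var mark == lit 0 THEN skip ELSE (blocked [ inc (var head) ]≔ lit 3)) ⨾
  left ≔ dec (var left)

scan = WHILE lit 0 << var left DO scan-body

find-body =
  (IF arr status (var idx) == arr blocked (var idx) THEN cand ≔ var idx ELSE (cand ≔ var cand)) ⨾
  blocked [ var idx ]≔ lit 0 ⨾
  idx ≔ dec (var idx)

find-cand : Program
find-cand = WHILE lit 0 << var idx DO find-body

search =
  ptr ≔ lit 2 ⨾
  left ≔ arr input (lit 1) ⨾
  scan ⨾
  cand ≔ lit 0 ⨾
  idx ≔ arr input (lit 0) ⨾
  find-cand

print-body =
  idx ≔ dec (var idx) ⨾
  (IF arr status (inc (var idx)) == lit 1 THEN write (var idx) ELSE skip)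

print = WHILE lit 0 << var idx DO print-body

push =
  depth ≔ inc (var depth) ⨾
  stack [ var depth ]≔ var cand ⨾
  status [ var cand ]≔ lit 1

flip =
  status [ arr stack (var depth) ]≔ lit 2 ⨾
  mode ≔ lit 0

pop =
  status [ arr stack (var depth) ]≔ lit 0 ⨾
  depth ≔ dec (var depth)

report forward backward body main : Program

report = idx ≔ arr input (lit 0) ⨾ print ⨾ flush ⨾ mode ≔ lit 1

forward = search ⨾ (IF var cand == lit 0 THEN report ELSE push)

backward = IF arr status (arr stack (var depth)) == lit 1 THEN flip ELSE pop

body = IF var mode == lit 0 THEN forward ELSE backward

-- The bottom of the stack, at depth 1, is a sentinel pointing to cell 0 of
-- `status`; popping it ends the main loop.
main = WHILE lit 0 << var depth DO body

enumerate : Program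
enumerate = depth ≔ lit 1 ⨾ main

-- The pass over the rules

Reads : ℕ → List ℕ → (ℕ → ℕ) → Set
Reads p u g = ∀ i → g (p + i) ≡ nth u i

reads-head : ∀ {x u} p g → Reads p (x ∷ u) g → g p ≡ x
reads-head p g r = trans (cong g (sym (ℕ.+-identityʳ p))) (r 0)

reads-tail : ∀ {x u} p g → Reads p (x ∷ u) g → Reads (suc p) u g
reads-tail p g r i = trans (cong g (sym (ℕ.+-suc p i))) (r (suc i))

Hit : State → ℕ → Set
Hit s x = x ≡ vars s head ⊎ arrs s status (suc x) ≡ 1

-- `m` and `m′` are the values of `mark` before and after the loop over `v`: a hit resets it to 0,
-- and nothing else changes it.
Marked : State → List ℕ → ℕ → ℕ → Set
Marked s v m m′ = (Any (Hit s) v × m′ ≡ 0) ⊎ (¬ Any (Hit s) v × m′ ≡ m)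

marked-hit : ∀ s {x v m m′} → Hit s x → Marked s v 0 m′ → Marked s (x ∷ v) m m′
marked-hit s h (inj₁ (_ , e)) = inj₁ (here h , e)
marked-hit s h (inj₂ (_ , e)) = inj₁ (here h , e)

marked-miss : ∀ s {x v m m′} → ¬ Hit s x → Marked s v m m′ → Marked s (x ∷ v) m m′
marked-miss s ¬h (inj₁ (a , e)) = inj₁ (there a , e)
marked-miss s ¬h (inj₂ (¬a , e)) = inj₂ ((λ { (here h) → ¬h h ; (there a) → ¬a a }) , e)

record Collected (s : State) (v u : List ℕ) (s′ : State) : Set where
  field
    arrs-same  : arrs s′ ≡ arrs s
    depth-same : vars s′ depth ≡ vars s depth
    mode-same  : vars s′ mode ≡ vars s mode
    left-same  : vars s′ left ≡ vars s left
    head-same  : vars s′ head ≡ vars s head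
    rest       : Reads (vars s′ ptr) u (arrs s input)
    marked     : Marked s v (vars s mark) (vars s′ mark)

run-collect : ∀ v u s → vars s len ≡ length v → Reads (vars s ptr) (v ++ u) (arrs s input) →
  Run collect s [] (suc (length v * 6)) (Collected s v u)
run-collect []      u s l r = run-while-zero l record
  { arrs-same = refl ; depth-same = refl ; mode-same = refl ; left-same = refl ; head-same = refl
  ; rest = r ; marked = inj₂ ((λ ()) , refl) }
run-collect (x ∷ v) u s l r = run-while-suc l (assoc-then (if-then
  -- This branch avoids the inner test and is one step shorter than the others.
  (λ e → weaken (ℕ.n≤1+n _) (assign-then (again 0 (marked-hit s (inj₁ (trans (sym x≡) e))))))
  λ ≢head → if-then
    (λ e → assign-then (again 0 (marked-hit s (inj₂ (trans (cong (arrs s status ∘ suc) (sym x≡)) e)))))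
    λ ≢1 → assign-then (again (vars s mark) (marked-miss s
      λ { (inj₁ e) → ≢head (trans x≡ e) ; (inj₂ e) → ≢1 (trans (cong (arrs s status ∘ suc) x≡) e) }))))
  where
  x≡ = reads-head (vars s ptr) (arrs s input) r
  again : ∀ m → (∀ {m′} → Marked s v m m′ → Marked s (x ∷ v) (vars s mark) m′) →
    Run ((ptr ≔ inc (var ptr) ⨾ len ≔ dec (var len)) ⨾ collect) (state (update (vars s) mark m) (arrs s)) []
      (3 + length v * 6) (Collected s (x ∷ v) u)
  again m mark⇒ = assoc-then (assign-then (assign-then (mono
    (λ c → let open Collected c in record
      { arrs-same = arrs-same ; depth-same = depth-same ; mode-same = mode-same ; left-same = left-same
      ; head-same = head-same ; rest = rest ; marked = mark⇒ marked })
    (run-collect v u _ (cong pred l) (reads-tail (vars s ptr) (arrs s input) r)))))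

-- `allFin` is the case `g = id`. The general `g` and `P` are there for the induction on `A`, which
-- shifts all indices by one.
length-filter-tabulate : ∀ {n} {X : Set} {P : X → Set} (P? : ∀ x → Dec (P x)) (g : Fin n → X) (A : Subset n) →
  (∀ i → i ∈ˢ A → P (g i)) → (∀ i → P (g i) → i ∈ˢ A) → length (filter P? (tabulate g)) ≡ ∣ A ∣
length-filter-tabulate P? g []          to from = refl
length-filter-tabulate P? g (true ∷ A)  to from rewrite List.filter-accept P? {xs = tabulate (g ∘ suc)} (to zero here) =
  cong suc (length-filter-tabulate P? (g ∘ suc) A (λ i → to (suc i) ∘ there) (λ i → drop-there ∘ from (suc i)))
length-filter-tabulate P? g (false ∷ A) to from
  rewrite List.filter-reject P? {xs = tabulate (g ∘ suc)} (λ p → contradiction (from zero p) λ ()) =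
  length-filter-tabulate P? (g ∘ suc) A (λ i → to (suc i) ∘ there) (λ i → drop-there ∘ from (suc i))

lists-length : ∀ {n v} (A : Subset n) → v Lists A → length v ≡ ∣ A ∣
lists-length A v↭ = trans (↭-length v↭) (trans (List.length-map toℕ (elements A))
  (length-filter-tabulate (_∈? A) id A (λ _ → id) (λ _ → id)))

lists-∈⁺ : ∀ {n v a} (A : Subset n) → v Lists A → a ∈ˢ A → toℕ a ∈ v
lists-∈⁺ A v↭ a∈A = ∈-resp-↭ (↭-sym v↭) (∈-map⁺ toℕ (∈-filter⁺ (_∈? A) (∈-allFin _) a∈A))

lists-∈⁻ : ∀ {n v x} (A : Subset n) → v Lists A → x ∈ v → ∃[ a ] a ∈ˢ A × x ≡ toℕ a
lists-∈⁻ A v↭ x∈v with a , a∈ , x≡ ← ∈-map⁻ toℕ (∈-resp-↭ v↭ x∈v) =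
  a , proj₂ (∈-filter⁻ (_∈? A) {xs = allFin _} a∈) , x≡

Displays : ∀ {n} → (Fin n → Mark) → State → Set
Displays f s = ∀ q → arrs s status (suc (toℕ q)) ≡ code (f q)

module _ {n} {f : Fin n → Mark} {v : List ℕ} {A : Subset n} {h : Fin n} (s : State)
         (disp : Displays f s) (v↭ : v Lists A) (head≡ : vars s head ≡ toℕ h) where

  hit⇒supported : Any (Hit s) v → Supported f h A
  hit⇒supported any with x , x∈v , hit ← find any with a , a∈A , refl ← lists-∈⁻ A v↭ x∈v = a , a∈A , reason hit
    where
    reason : Hit s (toℕ a) → a ≡ h ⊎ f a ≡ taken
    reason (inj₁ e) = inj₁ (Fin.toℕ-injective (trans e head≡))
    reason (inj₂ e) = inj₂ (code-injective (f a) taken (trans (sym (disp a)) e))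

  supported⇒hit : Supported f h A → Any (Hit s) v
  supported⇒hit (a , a∈A , reason) = lose (lists-∈⁺ A v↭ a∈A) (hit reason)
    where
    hit : a ≡ h ⊎ f a ≡ taken → Hit s (toℕ a)
    hit (inj₁ e) = inj₁ (trans (cong toℕ e) (sym head≡))
    hit (inj₂ e) = inj₂ (trans (disp a) (cong code e))

-- `b` and `b′` are the `blocked` entries of `q` before and after the scan. Stating the outcome
-- relative to `b` lets it compose rule by rule.
Verdict : ∀ {n} → (Fin n → Mark) → List (Rule n) → Fin n → ℕ → ℕ → Set
Verdict f R q b b′ = (b′ ≡ b × All (Permits f q) R) ⊎ (b′ ≡ 3 × ¬ All (Permits f q) R)

verdict-∷ : ∀ {n} (f : Fin n → Mark) {r R q b b₁ b′} →
  (b₁ ≡ b × Permits f q r) ⊎ (b₁ ≡ 3 × ¬ Permits f q r) → Verdict f R q b₁ b′ → Verdict f (r ∷ R) q b b′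
verdict-∷ f (inj₁ (refl , p))  (inj₁ (e , ps))  = inj₁ (e , p ∷ ps)
verdict-∷ f (inj₂ (refl , ¬p)) (inj₁ (e , ps))  = inj₂ (e , λ { (p ∷ _) → ¬p p })
verdict-∷ f _                  (inj₂ (e , ¬ps)) = inj₂ (e , λ { (_ ∷ ps) → ¬ps ps })

record Kept (s s′ : State) : Set where
  field
    input-same  : arrs s′ input ≡ arrs s input
    status-same : arrs s′ status ≡ arrs s status
    stack-same  : arrs s′ stack ≡ arrs s stack
    depth-same  : vars s′ depth ≡ vars s depth
    mode-same   : vars s′ mode ≡ vars s mode

kept-refl : ∀ {s} → Kept s s
kept-refl = record { input-same = refl ; status-same = refl ; stack-same = refl ; depth-same = refl ; mode-same = refl }

kept-trans : ∀ {s s′ s″} → Kept s s′ → Kept s′ s″ → Kept s s″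
kept-trans k k′ = record
  { input-same  = trans (input-same k′) (input-same k)
  ; status-same = trans (status-same k′) (status-same k)
  ; stack-same  = trans (stack-same k′) (stack-same k)
  ; depth-same  = trans (depth-same k′) (depth-same k)
  ; mode-same   = trans (mode-same k′) (mode-same k)
  }
  where open Kept

Scanned : ∀ {n} → (Fin n → Mark) → List (Rule n) → State → State → Set
Scanned f R s s′ = Kept s s′ ×
  (∀ q → Verdict f R q (arrs s blocked (suc (toℕ q))) (arrs s′ blocked (suc (toℕ q))))

-- A rule costs 10 steps plus 6 for each element of its body. Charging 10 per element too turns this
-- into 10 times its share of `size`, with slack 4 per element.
scan-time : ∀ k a l → k ≡ a → 6 + (suc (k * 6) + (3 + suc (l * 10))) ≤ suc ((a + 1 + l) * 10)
scan-time k _ l refl = subst (6 + (suc (k * 6) + (3 + suc (l * 10))) ≤_) (slack k l) (ℕ.m≤m+n _ (k * 4))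
  where
  slack : ∀ k l → 6 + (suc (k * 6) + (3 + suc (l * 10))) + k * 4 ≡ suc ((k + 1 + l) * 10)
  slack = solve-∀

run-scan : ∀ {n} {f : Fin n → Mark} ws (R : List (Rule n)) s → Pointwise _EncodesRule_ ws R →
  vars s left ≡ length R → Reads (vars s ptr) (concat ws) (arrs s input) → Displays f s →
  Run scan s [] (suc (size R * 10)) (Scanned f R s)
run-scan []       []            s []                       l r disp =
  run-while-zero l (kept-refl , λ q → inj₁ (refl , []))
run-scan {f = f} (_ ∷ ws) ((A , h) ∷ R) s ((v , v↭ , refl) ∷ enc) l r disp =
  weaken (scan-time (length v) ∣ A ∣ (size R) (lists-length A v↭)) (run-while-suc l
  (assoc-then (assign-then (assoc-then (assign-then (assoc-then (assign-then (assoc-then (assign-then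
  (assoc-then (assign-then (assoc-then (run-seq
    (run-collect v (concat ws) s₁ len≡ (reads-tail (suc p) g (reads-tail p g r)))
    λ { {state vs as} record { arrs-same = refl ; depth-same = d ; mode-same = m ; left-same = l′
                             ; head-same = h′ ; rest = r′ ; marked = mk } →
      assoc-then (if-then
        (λ mark≡0 → skip-then (assign-then (mono
          (λ { (kept , verdict) → kept-after refl refl refl d m kept , λ q → verdict-∷ f
            (inj₁ (refl , λ { refl → hit⇒supported s₁ disp v↭ head≡ (marked-0 mk mark≡0) }))
            (verdict q) })
          (run-scan ws R _ enc (cong pred (trans l′ l)) r′ disp))))
        λ mark≢0 → store-then (assign-then (mono
          (λ { (kept , verdict) → kept-after refl refl refl d m kept , λ q → verdict-∷ f
            (fail (trans h′ head≡) (marked-≢0 mk mark≢0 ∘ supported⇒hit s₁ disp v↭ head≡) q)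
            (verdict q) })
          (run-scan ws R _ enc (cong pred (trans l′ l)) r′ disp)))) })))))))))))))
  where
  p = vars s ptr
  g = arrs s input
  b = arrs s blocked
  s₁ : State
  s₁ = state
    (update (update (update (update (update (vars s) head (g p)) ptr (suc p)) len (g (suc p))) ptr (2 + p)) mark 3)
    (arrs s)
  kept-after : ∀ {s′ s″} → arrs s′ input ≡ arrs s input → arrs s′ status ≡ arrs s status →
    arrs s′ stack ≡ arrs s stack → vars s′ depth ≡ vars s depth → vars s′ mode ≡ vars s mode →
    Kept s′ s″ → Kept s s″
  kept-after i st sk d m = kept-trans
    (record { input-same = i ; status-same = st ; stack-same = sk ; depth-same = d ; mode-same = m })
  head≡ : g p ≡ toℕ h
  head≡ = reads-head p g r
  len≡ : g (suc p) ≡ length v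
  len≡ = reads-head (suc p) g (reads-tail p g r)
  marked-0 : ∀ {m} → Marked s₁ v 3 m → m ≡ 0 → Any (Hit s₁) v
  marked-0 (inj₁ (a , _)) _ = a
  marked-0 (inj₂ (_ , refl)) ()
  marked-≢0 : ∀ {m} → Marked s₁ v 3 m → m ≢ 0 → ¬ Any (Hit s₁) v
  marked-≢0 (inj₁ (_ , e)) ne = contradiction e ne
  marked-≢0 (inj₂ (¬a , _)) _ = ¬a
  fail : ∀ {x} → x ≡ toℕ h → ¬ Supported f h A → ∀ q →
    let b₁ = update b (suc x) 3 (suc (toℕ q)) in
    (b₁ ≡ b (suc (toℕ q)) × Permits f q (A , h)) ⊎ (b₁ ≡ 3 × ¬ Permits f q (A , h))
  fail refl ¬supp q with h Fin.≟ q
  ... | yes refl = inj₂ (update-≡ b (suc (toℕ h)) 3 , λ permit → ¬supp (permit refl))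
  ... | no h≢q = inj₁ (update-≢ b 3 (h≢q ∘ Fin.toℕ-injective ∘ ℕ.suc-injective) , λ h≡q → contradiction h≡q h≢q)

-- Selecting the least candidate

LeastBelow : (ℕ → Set) → ℕ → ℕ → ℕ → Set
LeastBelow P j c₀ c =
  (∃[ i ] i < j × P i × (∀ i′ → i′ < i → ¬ P i′) × c ≡ suc i) ⊎ ((∀ i → i < j → ¬ P i) × c ≡ c₀)

-- The search runs downward, so later hits are smaller and overwrite earlier ones; `c₁` is the
-- candidate once `j` has been tested. Two predicates appear because clearing a cell changes the
-- memory, though not below `j`.
least-below-suc : ∀ {P P′ : ℕ → Set} {j c₀ c₁ c} →
  (∀ i → i < j → P i → P′ i) → (∀ i → i < j → P′ i → P i) →
  (P j × c₁ ≡ suc j) ⊎ (¬ P j × c₁ ≡ c₀) → LeastBelow P′ j c₁ c → LeastBelow P (suc j) c₀ c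
least-below-suc to from _ (inj₁ (i , i<j , Pi , min , e)) =
  inj₁ (i , ℕ.m<n⇒m<1+n i<j , from i i<j Pi , (λ i′ i′<i p → min i′ i′<i (to i′ (ℕ.<-trans i′<i i<j) p)) , e)
least-below-suc to from (inj₁ (Pj , refl)) (inj₂ (none , e)) =
  inj₁ (_ , ℕ.≤-refl , Pj , (λ i i<j p → none i i<j (to i i<j p)) , e)
least-below-suc {P} {j = j} to from (inj₂ (¬Pj , refl)) (inj₂ (none , e)) = inj₂ (none′ , e)
  where
  none′ : ∀ i → i < suc j → ¬ P i
  none′ i i<1+j p with i ℕ.≟ j
  ... | yes refl = ¬Pj p
  ... | no i≢j = none i (ℕ.≤∧≢⇒< (s≤s⁻¹ i<1+j) i≢j) (to i (ℕ.≤∧≢⇒< (s≤s⁻¹ i<1+j) i≢j) p)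

Ready : State → ℕ → Set
Ready s i = arrs s status (suc i) ≡ arrs s blocked (suc i)

-- The loop also wipes `blocked`, so the next search starts clean. `above` carries the induction for
-- `cleared`: the cell wiped in one round is untouched by the later ones.
record Found (j : ℕ) (s s′ : State) : Set where
  field
    kept      : Kept s s′
    candidate : LeastBelow (Ready s) j (vars s cand) (vars s′ cand)
    cleared   : ∀ i → i < j → arrs s′ blocked (suc i) ≡ 0
    above     : ∀ i → j ≤ i → arrs s′ blocked (suc i) ≡ arrs s blocked (suc i)

run-find : ∀ j s → vars s idx ≡ j → Run find-cand s [] (suc (j * 5)) (Found j s)
run-find zero    s l = run-while-zero l record
  { kept = kept-refl ; candidate = inj₂ ((λ i ()) , refl) ; cleared = λ i () ; above = λ i _ → refl }
run-find (suc j) s l = run-while-suc l (assoc-then (if-then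
  (λ e → assign-then (again (vars s idx) (inj₁ (subst (λ x → arrs s status x ≡ arrs s blocked x) l e , l))))
  (λ ne → assign-then (again (vars s cand)
    (inj₂ (ne ∘ subst (λ x → arrs s status x ≡ arrs s blocked x) (sym l) , refl))))))
  where
  b = arrs s blocked
  b′ = update b (vars s idx) 0
  b′-other : ∀ {i} → i ≢ j → b′ (suc i) ≡ b (suc i)
  b′-other i≢j = update-≢ b 0 λ e → i≢j (sym (ℕ.suc-injective (trans (sym l) e)))
  b′-j : b′ (suc j) ≡ 0
  b′-j = trans (cong b′ (sym l)) (update-≡ b (vars s idx) 0)
  again : ∀ c₁ → (Ready s j × c₁ ≡ suc j) ⊎ (¬ Ready s j × c₁ ≡ vars s cand) →
    Run ((blocked [ var idx ]≔ lit 0 ⨾ idx ≔ dec (var idx)) ⨾ find-cand) (state (update (vars s) cand c₁) (arrs s)) []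
      (3 + j * 5) (Found (suc j) s)
  again c₁ h = assoc-then (store-then (assign-then (mono post (run-find j s₁ (cong pred l)))))
    where
    s₁ : State
    s₁ = state (update (update (vars s) cand c₁) idx (pred (vars s idx))) (update (arrs s) blocked b′)
    post : ∀ {s′} → Found j s₁ s′ → Found (suc j) s s′
    post {s′} fnd = record
      { kept      = kept-trans (record { input-same = refl ; status-same = refl ; stack-same = refl
                                       ; depth-same = refl ; mode-same = refl }) kept
      ; candidate = least-below-suc (λ i i<j e → trans e (sym (b′-other (ℕ.<⇒≢ i<j))))
                                    (λ i i<j e → trans e (b′-other (ℕ.<⇒≢ i<j))) h candidate
      ; cleared   = cleared′
      ; above     = λ i j<i → trans (above i (ℕ.<⇒≤ j<i)) (b′-other (ℕ.>⇒≢ j<i))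
      }
      where
      open Found fnd
      cleared′ : ∀ i → i < suc j → arrs s′ blocked (suc i) ≡ 0
      cleared′ i i<1+j with i ℕ.≟ j
      ... | yes refl = trans (above j ℕ.≤-refl) b′-j
      ... | no i≢j = cleared i (ℕ.≤∧≢⇒< (s≤s⁻¹ i<1+j) i≢j)

-- Printing a set

taken-cells : (ℕ → ℕ) → ℕ → List ℕ
taken-cells g n = filter (λ i → g (suc i) ℕ.≟ 1) (downFrom n)

reword : ∀ {P s ws ws′ t Q} → ws ≡ ws′ → Run P s ws t Q → Run P s ws′ t Q
reword refl r = r

record Printed (s s′ : State) : Set where
  field
    arrs-same  : arrs s′ ≡ arrs s
    depth-same : vars s′ depth ≡ vars s depth

run-print : ∀ j s → vars s idx ≡ j → Run print s (taken-cells (arrs s status) j) (suc (j * 4)) (Printed s)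
run-print zero    s l = run-while-zero l record { arrs-same = refl ; depth-same = refl }
run-print (suc j) s l = run-while-suc l (assoc-then (assign-then (if-then
  (λ e → reword (trans (cong (_∷ taken-cells g j) idx≡) (sym (List.filter-accept is-taken? (subst Taken idx≡ e))))
    (run-seq {s = s₁} {Q′ = _≡ s₁} (run-write refl) λ { refl → again }))
  (λ ne → reword (sym (List.filter-reject is-taken? (ne ∘ subst Taken (sym idx≡))))
    (skip-then again)))))
  where
  g = arrs s status
  s₁ : State
  s₁ = state (update (vars s) idx (pred (vars s idx))) (arrs s)
  Taken : ℕ → Set
  Taken i = g (suc i) ≡ 1
  is-taken? : ∀ i → Dec (Taken i)
  is-taken? i = g (suc i) ℕ.≟ 1
  idx≡ : pred (vars s idx) ≡ j
  idx≡ = cong pred l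
  again : Run print s₁ (taken-cells g j) (suc (j * 4)) (Printed s)
  again = mono (λ p → record { Printed p }) (run-print j s₁ idx≡)

module _ {n} (f : Fin n → Mark) (g : ℕ → ℕ) (disp : ∀ q → g (suc (toℕ q)) ≡ code (f q)) where

  -- Both lists are free of repetitions and have the same members, hence are permutations of each
  -- other, although the machine prints downward.
  taken-cells-lists : taken-cells g n Lists chosen f
  taken-cells-lists = ∼bag⇒↭ (unique∧set⇒bag
    (Unique.filter⁺ _ (Unique.downFrom⁺ n))
    (Unique.map⁺ Fin.toℕ-injective (Unique.filter⁺ _ (Unique.allFin⁺ n)))
    (mk⇔ to from))
    where
    to : ∀ {x} → x ∈ taken-cells g n → x ∈ map toℕ (elements (chosen f))
    to {x} x∈ with ∈-filter⁻ (λ i → g (suc i) ℕ.≟ 1) {xs = downFrom n} x∈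
    ... | x∈′ , gx = subst (_∈ _) (Fin.toℕ-fromℕ< x<n) (∈-map⁺ toℕ
      (∈-filter⁺ (_∈? chosen f) (∈-allFin q) (∈-chosen⁺ f (code-injective _ _
        (trans (sym (disp q)) (trans (cong (g ∘ suc) (Fin.toℕ-fromℕ< x<n)) gx))))))
      where
      x<n = ∈-downFrom⁻ x∈′
      q = fromℕ< x<n
    from : ∀ {x} → x ∈ map toℕ (elements (chosen f)) → x ∈ taken-cells g n
    from x∈ with q , q∈ , refl ← ∈-map⁻ toℕ x∈ =
      ∈-filter⁺ (λ i → g (suc i) ℕ.≟ 1) (∈-downFrom⁺ (Fin.toℕ<n q))
        (trans (disp q) (cong code (∈-chosen⁻ f (proj₂ (∈-filter⁻ (_∈? chosen f) {xs = allFin n} q∈)))))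

-- The stack and the marking in memory

Stacked : ∀ {n} → List (Fin n) → (ℕ → ℕ) → Set
Stacked []      g = g 1 ≡ 0
Stacked (q ∷ σ) g = g (suc (suc (length σ))) ≡ suc (toℕ q) × Stacked σ g

stacked-update : ∀ {n} (σ : List (Fin n)) {g m x} → suc (length σ) < m → Stacked σ g → Stacked σ (update g m x)
stacked-update []      {g} {x = x} m> top           = trans (update-≢ g x (ℕ.>⇒≢ m>)) top
stacked-update (q ∷ σ) {g} {x = x} m> (top , below) =
  trans (update-≢ g x (ℕ.>⇒≢ m>)) top , stacked-update σ (ℕ.<-trans ℕ.≤-refl m>) below

displays-update : ∀ {n} (f : Fin n → Mark) g {x} q m → x ≡ suc (toℕ q) →
  (∀ p → g (suc (toℕ p)) ≡ code (f p)) → ∀ p → update g x (code m) (suc (toℕ p)) ≡ code ((f [ q ↦ m ]) p)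
displays-update f g q m refl disp p with p Fin.≟ q
... | yes refl = trans (update-≡ g (suc (toℕ q)) (code m)) (cong code (sym (↦-≡ f q m)))
... | no p≢q = trans (update-≢ g (code m) (p≢q ∘ sym ∘ Fin.toℕ-injective ∘ ℕ.suc-injective))
                     (trans (disp p) (cong code (sym (↦-≢ f q m p≢q))))

↦-again : ∀ {n} (f : Fin n → Mark) q m m′ p → (f [ q ↦ m ] [ q ↦ m′ ]) p ≡ (f [ q ↦ m′ ]) p
↦-again f q m m′ p with p Fin.≟ q
... | yes refl = trans (↦-≡ (f [ q ↦ m ]) q m′) (sym (↦-≡ f q m′))
... | no p≢q = trans (↦-≢ (f [ q ↦ m ]) q m′ p≢q) (trans (↦-≢ f q m p≢q) (sym (↦-≢ f q m′ p≢q)))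

↦-same : ∀ {n} (f : Fin n → Mark) q m p → f q ≡ m → (f [ q ↦ m ]) p ≡ f p
↦-same f q m p e with p Fin.≟ q
... | yes refl = trans (↦-≡ f q m) (sym e)
... | no p≢q = ↦-≢ f q m p≢q

-- Traces with outputs and waiting times

-- The single `step` after the output is the change of `mode` that follows `flush`; it counts toward
-- the next waiting time.
record RunOut (P : Program) (s : State) (ws : List ℕ) (t : ℕ) (Q : State → Set) : Set where
  constructor ran-out
  field
    {final}  : State
    {before} : List Event
    exec     : ⟨ P , s ⟩⇓⟨ final , before ++ output ∷ step ∷ [] ⟩
    quiet    : Quiet before ws t
    post     : Q final

module _ {s : State} {Q : State → Set} where

  out-seq : ∀ {P P′ ws ws′ t t′ Q′} → Run P s ws t Q′ → (∀ {s′} → Q′ s′ → RunOut P′ s′ ws′ t′ Q) →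
    RunOut (P ⨾ P′) s (ws ++ ws′) (t + t′) Q
  out-seq {P} {P′} (ran {final} {τ} e o q) k with ran-out {final′} {τ′} e′ o′ q′ ← k q =
    ran-out (subst (λ τ → ⟨ P ⨾ P′ , s ⟩⇓⟨ final′ , τ ⟩) (sym (List.++-assoc τ τ′ _)) (seq e e′)) (quiet-++ o o′) q′

  out-assign : ∀ {x e P ws t} → RunOut P (state (update (vars s) x (⟦ e ⟧ᵉ s)) (arrs s)) ws t Q →
    RunOut (x ≔ e ⨾ P) s ws (suc t) Q
  out-assign (ran-out e o q) = ran-out (seq assign e) (quiet-step o) q

  out-reword : ∀ {P ws ws′ t} → ws ≡ ws′ → RunOut P s ws t Q → RunOut P s ws′ t Q
  out-reword refl r = r

  out-if : ∀ {d e P P′ ws t} → ⟦ d ⟧ᵉ s ≡ ⟦ e ⟧ᵉ s → RunOut P s ws t Q →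
    RunOut (IF d == e THEN P ELSE P′) s ws (suc t) Q
  out-if {d} eq (ran-out r o q) =
    ran-out (if-true (trans (cong (⟦ d ⟧ᵉ s ≡ᵇ_) (sym eq)) (≡ᵇ-refl (⟦ d ⟧ᵉ s))) r) (quiet-step o) q

  out-flush : ∀ {x e} → Q (state (update (vars s) x (⟦ e ⟧ᵉ s)) (arrs s)) → RunOut (flush ⨾ x ≔ e) s [] 0 Q
  out-flush q = ran-out {before = []} (seq flush assign) quiet-[] q

  out-weaken : ∀ {P ws t t′} → t ≤ t′ → RunOut P s ws t Q → RunOut P s ws t′ Q
  out-weaken t≤t′ (ran-out e (quietly o w t) q) = ran-out e (quietly o w (ℕ.≤-trans t t≤t′)) q

-- `Enumerates` with a bound `t` of its own for the wait before the first output, so that silent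
-- work can be put in front of a run and added to `t` alone.
data EnumeratesAfter {n : ℕ} (t d : ℕ) : List Event → List (Subset n) → Set where
  halt : ∀ {τ} → output ∉ₗ τ → written τ ≡ [] → length τ < t → EnumeratesAfter t d τ []
  next : ∀ {τ τ′ K Ks} → output ∉ₗ τ → written τ Lists K → length τ < t →
    Enumerates d τ′ Ks → EnumeratesAfter t d (τ ++ output ∷ τ′) (K ∷ Ks)

delay : ∀ {n c t d τ τ′} {Ks : List (Subset n)} → Quiet τ [] c → EnumeratesAfter t d τ′ Ks →
  EnumeratesAfter (c + t) d (τ ++ τ′) Ks
delay {c = c} {t} {τ = τ} (quietly o w c≤) (halt {τ′} o′ w′ t<) = halt (∉-++ τ o o′)
  (trans (written-++ τ τ′) (trans (cong (_++ written τ′) w) w′))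
  (subst (_< c + t) (sym (List.length-++ τ)) (ℕ.+-mono-≤-< c≤ t<))
delay {c = c} {t} {d} {τ} (quietly o w c≤) (next {τ′} {τ″} {K} {Ks} o′ l t< e) =
  subst (λ τ → EnumeratesAfter (c + t) d τ (K ∷ Ks)) (List.++-assoc τ τ′ _) (next (∉-++ τ o o′)
    (subst (_Lists K) (sym (trans (written-++ τ τ′) (cong (_++ written τ′) w))) l)
    (subst (_< c + t) (sym (List.length-++ τ)) (ℕ.+-mono-≤-< c≤ t<)) e)

after-≤ : ∀ {n t t′ d τ} {Ks : List (Subset n)} → t ≤ t′ → EnumeratesAfter t d τ Ks → EnumeratesAfter t′ d τ Ks
after-≤ t≤t′ (halt o w t<)   = halt o w (ℕ.<-≤-trans t< t≤t′)
after-≤ t≤t′ (next o l t< e) = next o l (ℕ.<-≤-trans t< t≤t′) e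

enumerates : ∀ {n t d τ} {Ks : List (Subset n)} → t ≤ d → EnumeratesAfter t d τ Ks → Enumerates d τ Ks
enumerates t≤d (halt o w t<)   = halt o w (ℕ.<-≤-trans t< t≤d)
enumerates t≤d (next o l t< e) = next o l (ℕ.<-≤-trans t< t≤d) e

-- The machine's walk through the tree

module Simulation {n} (R : List (Rule n)) (n≤size : n ≤ size R)
                  (ws : List (List ℕ)) (enc : Pointwise _EncodesRule_ ws R) where

  word : List ℕ
  word = n ∷ length R ∷ concat ws

  record Inv (f : Fin n → Mark) (σ : List (Fin n)) (s : State) : Set where
    field
      input≡   : arrs s input ≡ nth word
      displays : Displays f s
      status₀  : arrs s status 0 ≡ 0
      clear    : ∀ (q : Fin n) → arrs s blocked (suc (toℕ q)) ≡ 0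
      stacked  : Stacked σ (arrs s stack)
      depth≡   : vars s depth ≡ suc (length σ)

  Forward Backward : (Fin n → Mark) → List (Fin n) → State → Set
  Forward  f σ s = Inv f σ s × vars s mode ≡ 0
  Backward f σ s = Inv f σ s × vars s mode ≡ 1

  Choice : (Fin n → Mark) → ℕ → Set
  Choice f c = (c ≡ 0 × (∀ q → ¬ Addable R f q)) ⊎ (∃[ q ] c ≡ suc (toℕ q) × Least (Addable R f) q)

  search-time : ℕ
  search-time = 2 + (suc (size R * 10) + (2 + suc (n * 5)))

  module _ {f : Fin n → Mark} {s : State} (disp : Displays f s)
           (verdict : ∀ q → Verdict f R q 0 (arrs s blocked (suc (toℕ q)))) where

    ready⇒addable : ∀ q → Ready s (toℕ q) → Addable R f q
    ready⇒addable q e with verdict q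
    ... | inj₁ (b≡0 , ps) = code-injective (f q) undecided (trans (sym (disp q)) (trans e b≡0)) , ps
    ... | inj₂ (b≡3 , _)  with f q | trans (sym (disp q)) (trans e b≡3)
    ...   | undecided | ()
    ...   | taken     | ()
    ...   | barred    | ()

    addable⇒ready : ∀ q → Addable R f q → Ready s (toℕ q)
    addable⇒ready q (fq , ps) with verdict q
    ... | inj₁ (b≡0 , _) = trans (disp q) (trans (cong code fq) (sym b≡0))
    ... | inj₂ (_ , ¬ps) = contradiction ps ¬ps

    choice : ∀ {c} → LeastBelow (Ready s) n 0 c → Choice f c
    choice (inj₂ (none , c≡)) = inj₁ (c≡ , λ q add → none (toℕ q) (Fin.toℕ<n q) (addable⇒ready q add))
    choice (inj₁ (i , i<n , ready , min , c≡)) = inj₂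
      ( fromℕ< i<n
      , trans c≡ (cong suc (sym (Fin.toℕ-fromℕ< i<n)))
      , ready⇒addable _ (subst (Ready s) (sym (Fin.toℕ-fromℕ< i<n)) ready)
      , λ p p<q add → min (toℕ p) (subst (toℕ p <_) (Fin.toℕ-fromℕ< i<n) p<q) (addable⇒ready p add) )

  inv-kept : ∀ {f σ s s′} → Inv f σ s → Kept s s′ → (∀ (q : Fin n) → arrs s′ blocked (suc (toℕ q)) ≡ 0) → Inv f σ s′
  inv-kept inv kept clear′ = record
    { input≡   = trans input-same input≡
    ; displays = λ q → trans (cong (λ g → g (suc (toℕ q))) status-same) (displays q)
    ; status₀  = trans (cong (λ g → g 0) status-same) status₀
    ; clear    = clear′
    ; stacked  = subst (Stacked _) (sym stack-same) stacked
    ; depth≡   = trans depth-same depth≡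
    }
    where
    open Inv inv
    open Kept kept

  -- As `blocked` is zero beforehand, the verdicts of the scan are absolute. The equation for
  -- `status` lets the printed word refer to the state before the search.
  run-search : ∀ {f σ s} → Forward f σ s →
    Run search s [] search-time (λ s′ → Forward f σ s′ × Choice f (vars s′ cand) × arrs s′ status ≡ arrs s status)
  run-search {f} {σ} {s} (inv , mode≡) = assign-then (assign-then (run-seq
    (run-scan ws R s₁ enc (cong (λ g → g 1) input≡) (λ i → cong (λ g → g (2 + i)) input≡) displays)
    λ { {s₂} (kept , verdict) → assign-then (assign-then (mono
      (λ { {s′} fnd → let open Found fnd renaming (kept to kept′) in
        let all-kept = kept-trans {s₁} {s₂} {s′} kept (record { Kept kept′ }) in
        (inv-kept inv (record { Kept all-kept }) (λ q → cleared (toℕ q) (Fin.toℕ<n q)) ,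
         trans (Kept.mode-same all-kept) mode≡) ,
        choice {f} {s₂} (λ q → trans (cong (λ g → g (suc (toℕ q))) (Kept.status-same kept)) (displays q))
          (λ q → subst (λ b → Verdict f R q b _) (clear q) (verdict q)) candidate ,
        Kept.status-same all-kept })
      (run-find n _ (cong (λ g → g 0) (trans (Kept.input-same kept) input≡))))) }))
    where
    open Inv inv
    s₁ : State
    s₁ = state (update (update (vars s) ptr 2) left (arrs s input 1)) (arrs s)

  run-push : ∀ {f σ s q} → Forward f σ s → vars s cand ≡ suc (toℕ q) →
    Run push s [] 3 (Forward (f [ q ↦ taken ]) (q ∷ σ))
  run-push {f} {σ} {s} {q} (inv , mode≡) c≡ = assign-then (store-then (run-store (record
    { input≡   = input≡
    ; displays = displays-update f (arrs s status) q taken c≡ displays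
    ; status₀  = trans (update-≢ (arrs s status) 1 (λ e → ℕ.0≢1+n (trans (sym e) c≡))) status₀
    ; clear    = clear
    ; stacked  = trans (cong (update (arrs s stack) (suc (vars s depth)) (vars s cand)) (sym d≡))
                   (trans (update-≡ (arrs s stack) (suc (vars s depth)) _) c≡)
               , stacked-update σ (ℕ.≤-reflexive (sym d≡)) stacked
    ; depth≡   = d≡
    } , mode≡)))
    where
    open Inv inv
    d≡ : suc (vars s depth) ≡ suc (suc (length σ))
    d≡ = cong suc depth≡

  run-report : ∀ {f σ s} → Forward f σ s → RunOut report s (taken-cells (arrs s status) n) (2 + n * 4) (Backward f σ)
  run-report {f} {σ} {s} (inv , mode≡) = out-reword (List.++-identityʳ _)
    (out-weaken (ℕ.≤-reflexive (cong (2 +_) (ℕ.+-identityʳ _)))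
      (out-assign (out-seq (run-print n _ (cong (λ g → g 0) input≡))
        λ { {state vs as} record { arrs-same = refl ; depth-same = d } → out-flush (record
          { input≡ = input≡ ; displays = displays ; status₀ = status₀ ; clear = clear ; stacked = stacked
          ; depth≡ = trans d depth≡ } , refl) })))
    where open Inv inv

  run-flip : ∀ {f q σ s} → Backward (f [ q ↦ taken ]) (q ∷ σ) s →
    Run body s [] 4 (Forward (f [ q ↦ barred ]) (q ∷ σ))
  run-flip {f} {q} {σ} {s} (inv , mode≡) = run-if
    (λ e → contradiction (trans (sym mode≡) e) λ ())
    λ _ → run-if
      (λ _ → store-then (run-assign (record
        { input≡   = input≡
        ; displays = λ p → trans (displays-update (f [ q ↦ taken ]) (arrs s status) q barred top≡ displays p)
                             (cong code (↦-again f q taken barred p))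
        ; status₀  = trans (update-≢ (arrs s status) 2 (λ e → ℕ.0≢1+n (trans (sym e) top≡))) status₀
        ; clear    = clear
        ; stacked  = stacked
        ; depth≡   = depth≡
        } , refl)))
      λ ne → contradiction (trans (cong (arrs s status) top≡) (trans (displays q) (cong code (↦-≡ f q taken)))) ne
    where
    open Inv inv
    top≡ : arrs s stack (vars s depth) ≡ suc (toℕ q)
    top≡ = trans (cong (arrs s stack) depth≡) (proj₁ stacked)

  run-pop : ∀ {f q σ s} → f q ≡ undecided → Backward (f [ q ↦ barred ]) (q ∷ σ) s →
    Run body s [] 4 (Backward f σ)
  run-pop {f} {q} {σ} {s} fq (inv , mode≡) = run-if
    (λ e → contradiction (trans (sym mode≡) e) λ ())
    λ _ → run-if
      (λ e → contradiction
        (trans (sym e) (trans (cong (arrs s status) top≡) (trans (displays q) (cong code (↦-≡ f q barred))))) λ ())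
      λ _ → store-then (run-assign (record
        { input≡   = input≡
        ; displays = λ p → trans (displays-update (f [ q ↦ barred ]) (arrs s status) q undecided top≡ displays p)
                             (cong code (trans (↦-again f q barred undecided p) (↦-same f q undecided p fq)))
        ; status₀  = trans (update-≢ (arrs s status) 0 (λ e → ℕ.0≢1+n (trans (sym e) top≡))) status₀
        ; clear    = clear
        ; stacked  = proj₂ stacked
        ; depth≡   = cong pred depth≡
        } , mode≡))
    where
    open Inv inv
    top≡ : arrs s stack (vars s depth) ≡ suc (toℕ q)
    top≡ = trans (cong (arrs s stack) depth≡) (proj₁ stacked)

  -- The sentinel points to cell 0 of `status`, which is never 1, so the program pops and the depth
  -- drops to 0.
  run-end : ∀ {f s} → Backward f [] s → Run body s [] 4 (λ s′ → vars s′ depth ≡ 0)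
  run-end {f} {s} (inv , mode≡) = run-if
    (λ e → contradiction (trans (sym mode≡) e) λ ())
    λ _ → run-if
      (λ e → contradiction (trans (sym e) (trans (cong (arrs s status) top≡) status₀)) λ ())
      λ _ → store-then (run-assign (cong pred depth≡))
    where
    open Inv inv
    top≡ : arrs s stack (vars s depth) ≡ 0
    top≡ = trans (cong (arrs s stack) depth≡) stacked

  -- A bound for one iteration of the main loop: 10l for the scan, 5n for finding the candidate and
  -- 4n for printing give 19l by n ≤ l.
  round : ℕ
  round = 20 + size R * 19

  -- It covers 2 + 2n rounds and one more step: 41 + 40n + 38l + 38nl, where n and l are at most nl,
  -- is at most 41 + 116nl.
  max-delay : ℕ
  max-delay = 120 * suc (n * size R)

  -- A potential. A pop shortens the stack and releases one round, more than it costs; at a flip the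
  -- remaining rounds suffice for descending to the next leaf.
  backward-time : List (Fin n) → ℕ
  backward-time σ = (2 + (length σ + n)) * round

  push-time : 1 + (search-time + 4) ≤ 19 + size R * 19
  push-time = begin
    1 + (search-time + 4)               ≡⟨ expand (size R) n ⟩
    11 + size R * 10 + n * 5            ≤⟨ ℕ.+-monoʳ-≤ (11 + size R * 10) (ℕ.*-monoˡ-≤ 5 n≤size) ⟩
    11 + size R * 10 + size R * 5       ≤⟨ ℕ.m≤m+n _ (8 + size R * 4) ⟩
    11 + size R * 10 + size R * 5 + (8 + size R * 4) ≡⟨ collapse (size R) ⟩
    19 + size R * 19                    ∎
    where
    open ℕ.≤-Reasoning
    expand : ∀ l n → 1 + ((2 + (suc (l * 10) + (2 + suc (n * 5)))) + 4) ≡ 11 + l * 10 + n * 5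
    expand = solve-∀
    collapse : ∀ l → 11 + l * 10 + l * 5 + (8 + l * 4) ≡ 19 + l * 19
    collapse = solve-∀

  report-time : 2 + (1 + (search-time + (1 + (2 + n * 4)))) ≤ round
  report-time = begin
    2 + (1 + (search-time + (1 + (2 + n * 4)))) ≡⟨ expand (size R) n ⟩
    12 + size R * 10 + n * 9            ≤⟨ ℕ.+-monoʳ-≤ (12 + size R * 10) (ℕ.*-monoˡ-≤ 9 n≤size) ⟩
    12 + size R * 10 + size R * 9       ≤⟨ ℕ.m≤m+n _ 8 ⟩
    12 + size R * 10 + size R * 9 + 8   ≡⟨ collapse (size R) ⟩
    round                               ∎
    where
    open ℕ.≤-Reasoning
    expand : ∀ l n → 2 + (1 + ((2 + (suc (l * 10) + (2 + suc (n * 5)))) + (1 + (2 + n * 4)))) ≡ 12 + l * 10 + n * 9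
    expand = solve-∀
    collapse : ∀ l → 12 + l * 10 + l * 9 + 8 ≡ 20 + l * 19
    collapse = solve-∀

  rounds-time : ∀ m → m ≤ 2 + (n + n) → suc (m * round) ≤ max-delay
  rounds-time m m≤ = begin
    suc (m * round)                                      ≤⟨ s≤s (ℕ.*-monoˡ-≤ round m≤) ⟩
    suc ((2 + (n + n)) * round)                          ≡⟨ expand n l ⟩
    41 + n * 40 + l * 38 + n * l * 38                    ≤⟨ ℕ.+-monoˡ-≤ (n * l * 38)
      (ℕ.+-mono-≤ (ℕ.+-monoʳ-≤ 41 (ℕ.*-monoˡ-≤ 40 n≤nl)) (ℕ.*-monoˡ-≤ 38 l≤nl)) ⟩
    41 + n * l * 40 + n * l * 38 + n * l * 38            ≤⟨ ℕ.m≤m+n _ (79 + n * l * 4) ⟩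
    41 + n * l * 40 + n * l * 38 + n * l * 38 + (79 + n * l * 4) ≡⟨ collapse (n * l) ⟩
    max-delay                                            ∎
    where
    open ℕ.≤-Reasoning
    l = size R
    expand : ∀ n l → suc ((2 + (n + n)) * (20 + l * 19)) ≡ 41 + n * 40 + l * 38 + n * l * 38
    expand = solve-∀
    collapse : ∀ x → 41 + x * 40 + x * 38 + x * 38 + (79 + x * 4) ≡ 120 * suc x
    collapse = solve-∀
    n≤nl : n ≤ n * l
    n≤nl = n≤n*m n≤size
      where
      n≤n*m : ∀ {n m} → n ≤ m → n ≤ n * m
      n≤n*m z≤n               = z≤n
      n≤n*m {n} {suc m} (s≤s _) = ℕ.m≤m*n n (suc m)
    l≤nl : l ≤ n * l
    l≤nl = size≤ R
      where
      size≤ : ∀ {n} (R : List (Rule n)) → size R ≤ n * size R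
      size≤ []                          = z≤n
      -- The head of a rule is an element of `Fin n`, so a nonempty list forces n to be positive.
      size≤ {suc n} R@(_ ∷ _) = ℕ.m≤n*m (size R) (suc n)

  record Halts (s : State) (t : ℕ) (Ks : List (Subset n)) : Set where
    constructor halts
    field
      {final} : State
      {trace} : List Event
      exec    : ⟨ main , s ⟩⇓⟨ final , trace ⟩
      outputs : EnumeratesAfter t max-delay trace Ks

  halts-≤ : ∀ {s t t′ Ks} → t ≤ t′ → Halts s t Ks → Halts s t′ Ks
  halts-≤ t≤t′ (halts e o) = halts e (after-≤ t≤t′ o)

  iterate : ∀ {s d c t Ks Q} → vars s depth ≡ suc d → Run body s [] c Q →
    (∀ {s′} → Q s′ → Halts s′ t Ks) → Halts s (suc c + t) Ks
  iterate d≡ (ran e o q) continue with halts e′ o′ ← continue q =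
    halts (while-true (cong (0 <ᵇ_) d≡) e e′) (delay (quiet-step o) o′)

  iterate-out : ∀ {s d v c t t′ K Ks Q} → vars s depth ≡ suc d → RunOut body s v c Q → v Lists K →
    suc c < t → suc t′ ≤ max-delay → (∀ {s′} → Q s′ → Halts s′ t′ Ks) → Halts s t (K ∷ Ks)
  iterate-out {s} d≡ (ran-out {before = τ} e o q) v↭ c<t t′<max continue
    with halts {final} {τ′} e′ o′ ← continue q | quietly silent refl time ← quiet-step o = halts
    (subst (λ τ → ⟨ main , s ⟩⇓⟨ final , τ ⟩) (cong (step ∷_) (List.++-assoc τ (output ∷ step ∷ []) τ′))
      (while-true (cong (0 <ᵇ_) d≡) e e′))
    -- The output resets the clock; the step after it is charged to the continuation.
    (next silent v↭ (ℕ.≤-<-trans time c<t) (enumerates t′<max (delay (quiet-step quiet-[]) o′)))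

  least-unique : ∀ {P : Fin n → Set} {p q} → Least P p → Least P q → p ≡ q
  least-unique {p = p} {q} (Pp , min-p) (Pq , min-q) with Fin.<-cmp p q
  ... | tri< p<q _ _ = contradiction Pp (min-q p p<q)
  ... | tri≈ _ p≡q _ = p≡q
  ... | tri> _ _ q<p = contradiction Pq (min-p q q<p)

  run-extend : ∀ {f σ s q} → Forward f σ s → Least (Addable R f) q →
    Run body s [] (19 + size R * 19) (Forward (f [ q ↦ taken ]) (q ∷ σ))
  run-extend fwd@(_ , mode≡) least = weaken push-time (run-if
    (λ _ → run-seq (run-search fwd)
      λ { (_ , inj₁ (_ , none) , _) → contradiction (proj₁ least) (none _)
        ; (fwd′ , inj₂ (p , c≡ , least′) , _) → run-if
            (λ c≡0 → contradiction (trans (sym c≡0) c≡) ℕ.0≢1+n)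
            λ _ → run-push fwd′ (trans c≡ (cong (suc ∘ toℕ) (least-unique least′ least))) })
    λ ne → contradiction mode≡ ne)

  run-leaf : ∀ {f σ s} → Forward f σ s → (∀ q → ¬ Addable R f q) →
    RunOut body s (taken-cells (arrs s status) n) (1 + (search-time + (1 + (2 + n * 4)))) (Backward f σ)
  run-leaf fwd@(_ , mode≡) none = out-if mode≡ (out-seq (run-search fwd)
    λ { (fwd′ , inj₁ (c≡0 , _) , same) →
          out-if c≡0 (out-reword (cong (λ g → taken-cells g n) same) (run-report fwd′))
      ; (_ , inj₂ (q , _ , add , _) , _) → contradiction add (none q) })

  -- `continue` is the rest of the run once the subtree is exhausted, when marking and stack are as
  -- on entry, and `rest` is what it outputs. The first leaf is reached within k pushes and one
  -- report, whence `suc k` rounds. Stack height and remaining height add up to n.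
  simulate : ∀ {k f Ks} → Tree R k f Ks → ∀ σ {s rest} → length σ + k ≡ n → Forward f σ s →
    (∀ {s′} → Backward f σ s′ → Halts s′ (backward-time σ) rest) → Halts s (suc k * round) (Ks ++ rest)
  simulate {k} {f} (leaf none) σ {s} size≡ fwd@(inv , _) continue =
    iterate-out (Inv.depth≡ inv) (run-leaf fwd none)
      (taken-cells-lists f (arrs s status) (Inv.displays inv))
      (ℕ.≤-trans report-time (ℕ.m≤m+n round (k * round)))
      (rounds-time (2 + (length σ + n)) (ℕ.+-monoʳ-≤ 2 (ℕ.+-monoˡ-≤ n (ℕ.m+n≤o⇒m≤o (length σ) (ℕ.≤-reflexive size≡)))))
      continue
  simulate {suc k} {f} (node {q = q} {Ks} {Ls} least t u) σ {s} {rest} size≡ fwd@(inv , _) continue =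
    subst (Halts s (suc (suc k) * round)) (sym (List.++-assoc Ks Ls rest))
      (iterate (Inv.depth≡ inv) (run-extend fwd least) λ fwd′ → simulate t (q ∷ σ) size≡′ fwd′
        -- The half with `q` taken is done: flip, walk through the half with `q` barred, then pop
        -- back to `f`.
        λ bwd@(inv′ , _) → halts-≤ flip-time (iterate (Inv.depth≡ inv′) (run-flip bwd) λ fwd″ →
          simulate u (q ∷ σ) size≡′ fwd″ λ bwd@(inv″ , _) → halts-≤ (step≤round _)
            (iterate (Inv.depth≡ inv″) (run-pop (proj₁ (proj₁ least)) bwd) continue)))
    where
    size≡′ : suc (length σ) + k ≡ n
    size≡′ = trans (sym (ℕ.+-suc (length σ) k)) size≡
    step≤round : ∀ t → 5 + t ≤ round + t
    step≤round t = ℕ.+-monoˡ-≤ t (ℕ.m≤m+n 5 (15 + size R * 19))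
    flip-time : 5 + suc k * round ≤ backward-time (q ∷ σ)
    flip-time = ℕ.≤-trans (step≤round _) (ℕ.*-monoˡ-≤ round (s≤s (s≤s (ℕ.≤-trans
      (ℕ.m+n≤o⇒n≤o (suc (length σ)) (ℕ.≤-reflexive size≡′)) (ℕ.m≤n+m n (suc (length σ)))))))

  halts-end : ∀ {f s} → Backward f [] s → Halts s (backward-time []) []
  halts-end bwd@(inv , _) = halts-≤ 7≤ (iterate (Inv.depth≡ inv) (run-end bwd)
    λ d≡0 → halts (while-false (cong (0 <ᵇ_) d≡0)) (halt (λ { (here ()) ; (there ()) }) refl (s≤s (s≤s z≤n))))
    where
    7≤ : 7 ≤ backward-time []
    7≤ = ℕ.≤-trans (ℕ.m≤m+n 7 (13 + size R * 19)) (ℕ.m≤m+n round ((1 + n) * round))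

theorem3p5 : Σ[ P ∈ Program ] Σ[ C ∈ ℕ ]
    ((n : ℕ) (R : List (Rule n)) → Unique R → n ≤ size R →
    (w : List ℕ) → w Encodes R →
    ∃[ s ] ∃[ τ ] Σ[ Ks ∈ List (Subset n) ]
    (⟨ P , load w ⟩⇓⟨ s , τ ⟩ ×
    Unique Ks ×
    ((K : Subset n) → K ∈ Ks ⇔ 𝒜 R K) ×
    Enumerates (C * suc (n * size R)) τ Ks))
theorem3p5 = enumerate , 120 , proof
  where
  proof : (n : ℕ) (R : List (Rule n)) → Unique R → n ≤ size R → (w : List ℕ) → w Encodes R →
    ∃[ s ] ∃[ τ ] Σ[ Ks ∈ List (Subset n) ]
      (⟨ enumerate , load w ⟩⇓⟨ s , τ ⟩ × Unique Ks × ((K : Subset n) → K ∈ Ks ⇔ 𝒜 R K) ×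
       Enumerates (120 * suc (n * size R)) τ Ks)
  proof n R _ n≤size _ (ws , enc , refl) with tree R n (λ _ → undecided) ⊤ (λ _ _ → ∈⊤) (ℕ.≤-reflexive (∣⊤∣≡n n))
  ... | Ks , t = finish (simulate t [] refl start halts-end)
    where
    open Simulation R n≤size ws enc
    root : Fin n → Mark
    root _ = undecided
    start : Forward root [] (state (update (λ _ → 0) depth 1) (arrs (load word)))
    start = record { input≡ = refl ; displays = λ _ → refl ; status₀ = refl ; clear = λ _ → refl
                   ; stacked = refl ; depth≡ = refl } , refl
    𝒜-root : 𝒜 R (chosen root)
    𝒜-root = subst (𝒜 R) (⊆-antisym (λ q∈ → contradiction q∈ ∉⊥) (λ q∈ → contradiction (∈-chosen⁻ root q∈) λ ())) 𝒜-∅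
    finish : Halts _ _ (Ks ++ []) → _
    finish (halts e o) = _ , _ , Ks , seq assign e , tree-unique t ,
      (λ K → mk⇔ (tree-sound t 𝒜-root) (λ 𝒜K → tree-complete t 𝒜K λ q → (λ ()) , λ ())) ,
      -- Before the first output there are at most n pushes and one report, preceded by the initial
      -- assignment to `depth`.
      enumerates (rounds-time (suc n) (s≤s (ℕ.≤-trans (ℕ.m≤m+n n n) (ℕ.n≤1+n _))))
        (delay (quiet-step quiet-[]) (subst (EnumeratesAfter _ _ _) (List.++-identityʳ Ks) o))
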